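{- Let $\gamma\colon\omega\to S$ be a precomplete numbering of a set $S$, and let $A\subseteq\omega$ be a computably enumerable set with $A<_T\emptyset'$ (i.e. $A$ is Turing incomplete). If $g\colon\omega\to\omega$ is a (total) $A$-computable function, then $g$ has a fixed point modulo $\sim_\gamma$, i.e. there exists $n\in\omega$ such that $g(n)\sim_\gamma n$.
   Context: $\omega$ denotes the set of natural numbers and $\emptyset'$ the halting set; $\leq_T$ is Turing reducibility, and $A<_T\emptyset'$ means $A\leq_T\emptyset'$ and $\emptyset'\not\leq_T A$. A numbering of a set $S$ is a surjection $\gamma\colon\omega\to S$. Given $\gamma$, write $n\sim_\gamma m$ if $\gamma(n)=\gamma(m)$. The numbering $\gamma$ is precomplete if for every partial computable unary function $\psi$ there exists a total computable unary function $f$ such that for every $n$: if $\psi(n)$ is defined, then $f(n)\sim_\gamma\psi(n)$. A function is $A$-computable if it is computable by a Turing machine with oracle $A$. -}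

module Defs where

open import Axiom.ExcludedMiddle using (ExcludedMiddle)
open import Data.Bool.Base using (Bool; true; false; if_then_else_)
import Data.Bool.Properties as Bool
open import Data.List.Base using (List; []; _∷_; _++_; map; find; filter; length; replicate)
open import Data.Maybe.Base using (Maybe; just; nothing)
import Data.Maybe.Base as Maybe
open import Data.Nat.Base using (ℕ; zero; suc; pred; _+_)
import Data.Nat.Properties as ℕ
open import Data.Product.Base using (_×_; _,_; ∃-syntax)
open import Function.Bundles using (Surjection; _⇔_)
open import Level as Level using (Level; 0ℓ; _⊔_)
open import Relation.Binary.Bundles using (Setoid)
open import Relation.Binary.PropositionalEquality using (_≡_; setoid)
open import Relation.Nullary using (¬_; Dec; does)
open import Relation.Nullary.Decidable using (_×-dec_)
open import Relation.Unary using (Pred)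

private
  variable
    c ℓ : Level

------------------------------------------------------------------------
-- Oracle Turing machines
--
-- A machine has one two-way infinite work tape and one read-only oracle
-- tape, whose cells 0, 1, 2, … carry the characteristic function of the
-- oracle.  Each head moves independently.

-- The alphabet of a machine is the finite set of numbers occurring in its
-- program, together with the following two.
Symbol : Set
Symbol = ℕ

blank stroke : Symbol
blank  = 0
stroke = 1

State : Set
State = ℕ

data Move : Set where
  left stay right : Move

-- In state `state`, scanning `symbol` on the work tape and `answer` on the
-- oracle tape: print `write`, move the two heads, go to state `next`.
record Instruction : Set where
  constructor instruction
  field
    state      : State
    symbol     : Symbol
    answer     : Bool
    next       : State
    write      : Symbol
    move       : Move
    oracleMove : Move

-- If several instructions apply, the first one in the list is executed;
-- if none applies, the machine halts.
Program : Set
Program = List Instruction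

-- `before` lists the cells to the left of the head, nearest first; cells
-- beyond the ends of the two lists are blank.
record Tape : Set where
  constructor tape
  field
    before  : List Symbol
    scanned : Symbol
    after   : List Symbol

print : Symbol → Tape → Tape
print s (tape ls _ rs) = tape ls s rs

shift : Move → Tape → Tape
shift left  (tape []       s rs)       = tape []       blank (s ∷ rs)
shift left  (tape (l ∷ ls) s rs)       = tape ls       l     (s ∷ rs)
shift stay  t                          = t
shift right (tape ls       s [])       = tape (s ∷ ls) blank []
shift right (tape ls       s (r ∷ rs)) = tape (s ∷ ls) r     rs

-- The oracle head stays put when told to move left from cell 0.
shiftOracle : Move → ℕ → ℕ
shiftOracle left  i = pred i
shiftOracle stay  i = i
shiftOracle right i = suc i

record Configuration : Set where
  constructor config
  field
    state  : State
    work   : Tape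
    oracle : ℕ

Oracle : Set
Oracle = ℕ → Bool

Applies : State → Symbol → Bool → Instruction → Set
Applies q s b I = state ≡ q × symbol ≡ s × answer ≡ b
  where open Instruction I

applies? : ∀ q s b I → Dec (Applies q s b I)
applies? q s b I = (state ℕ.≟ q) ×-dec (symbol ℕ.≟ s) ×-dec (answer Bool.≟ b)
  where open Instruction I

execute : Configuration → Instruction → Configuration
execute (config _ t i) I =
  config next (shift move (print write t)) (shiftOracle oracleMove i)
  where open Instruction I

step : Oracle → Program → Configuration → Maybe Configuration
step χ P C = Maybe.map (execute C) (find (applies? state (Tape.scanned work) (χ oracle)) P)
  where open Configuration C

-- Running P from the first configuration halts in the second one.
data _,_⊢_⇓_ (χ : Oracle) (P : Program) : Configuration → Configuration → Set where
  halt : ∀ {C} → step χ P C ≡ nothing → χ , P ⊢ C ⇓ C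
  run  : ∀ {C C′ D} → step χ P C ≡ just C′ → χ , P ⊢ C′ ⇓ D → χ , P ⊢ C ⇓ D

-- The input n is a block of n + 1 strokes, scanned at its leftmost cell;
-- the output is the number of strokes on the tape after halting.
initial : ℕ → Configuration
initial n = config 0 (tape [] stroke (replicate n stroke)) 0

output : Configuration → ℕ
output (config _ (tape ls s rs) _) = length (filter (ℕ._≟ stroke) (ls ++ s ∷ rs))

Halts : Oracle → Program → ℕ → Set
Halts χ P n = ∃[ D ] χ , P ⊢ initial n ⇓ D

Outputs : Oracle → Program → ℕ → ℕ → Set
Outputs χ P n m = ∃[ D ] (χ , P ⊢ initial n ⇓ D) × output D ≡ m

ComputableWith : Oracle → (ℕ → ℕ) → Set
ComputableWith χ f = ∃[ P ] ∀ n → Outputs χ P n (f n)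

-- Machines without an oracle are run on an oracle tape that carries no
-- information.
noOracle : Oracle
noOracle _ = false

Computable : (ℕ → ℕ) → Set
Computable = ComputableWith noOracle

-- A partial function is represented by its graph.
PartialComputable : (ℕ → ℕ → Set) → Set
PartialComputable ψ = ∃[ P ] ∀ n m → ψ n m ⇔ Outputs noOracle P n m

-- A set is computably enumerable if it is the domain of a partial
-- computable function.
ComputablyEnumerable : Pred ℕ 0ℓ → Set
ComputablyEnumerable A = ∃[ P ] ∀ n → A n ⇔ Halts noOracle P n

------------------------------------------------------------------------
-- The halting set

triangle : ℕ → ℕ
triangle zero    = 0
triangle (suc n) = suc n + triangle n

-- Cantor's pairing function
pair : ℕ → ℕ → ℕ
pair x y = triangle (x + y) + y

codeList : List ℕ → ℕ
codeList []       = 0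
codeList (x ∷ xs) = suc (pair x (codeList xs))

codeMove : Move → ℕ
codeMove left  = 0
codeMove stay  = 1
codeMove right = 2

bit : Bool → ℕ
bit b = if b then 1 else 0

codeInstruction : Instruction → ℕ
codeInstruction (instruction q s b q′ s′ d e) =
  codeList (q ∷ s ∷ bit b ∷ q′ ∷ s′ ∷ codeMove d ∷ codeMove e ∷ [])

⌜_⌝ : Program → ℕ
⌜ P ⌝ = codeList (map codeInstruction P)

∅′ : Pred ℕ 0ℓ
∅′ n = ∃[ P ] n ≡ ⌜ P ⌝ × Halts noOracle P n

------------------------------------------------------------------------
-- Relative computability
--
-- Excluded middle is what gives an arbitrary set of numbers a
-- characteristic function.

module Relative (em : ExcludedMiddle 0ℓ) where

  characteristic : Pred ℕ 0ℓ → Oracle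
  characteristic A n = does (em {A n})

  _-Computable_ : Pred ℕ 0ℓ → (ℕ → ℕ) → Set
  A -Computable f = ComputableWith (characteristic A) f

  infix 4 _≤T_ _<T_

  _≤T_ : Pred ℕ 0ℓ → Pred ℕ 0ℓ → Set
  B ≤T A = A -Computable (λ n → bit (characteristic B n))

  _<T_ : Pred ℕ 0ℓ → Pred ℕ 0ℓ → Set
  A <T B = A ≤T B × ¬ (B ≤T A)

------------------------------------------------------------------------
-- Numberings

-- The numbered set is a setoid, so that it may be a quotient.
Numbering : Setoid c ℓ → Set (c ⊔ ℓ)
Numbering S = Surjection (setoid ℕ) S

infix 4 _∼[_]_

_∼[_]_ : {S : Setoid c ℓ} → ℕ → Numbering S → ℕ → Set ℓ
_∼[_]_ {S = S} n γ m = to n ≈ to m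
  where
  open Setoid S using (_≈_)
  open Surjection γ using (to)

Precomplete : {S : Setoid c ℓ} → Numbering S → Set (Level.suc 0ℓ ⊔ ℓ)
Precomplete γ =
  (ψ : ℕ → ℕ → Set) → PartialComputable ψ →
  ∃[ f ] Computable f × (∀ n m → ψ n m → f n ∼[ γ ] m)

{-# OPTIONS --safe #-}

-- Arslanov's argument.  Let gₜ(y) be the approximation to g(y) computed in t
-- steps from the stage t of an enumeration of A.  Since A is computably
-- enumerable, A computes a modulus: a stage p(y) with gₜ(y) = g(y) for all
-- t ≥ p(y).  By precompleteness there is a computable h such that
-- h(x) ∼ gₖ(h(x)) whenever x enters ∅′, at stage k.  If g has no fixed point
-- modulo γ, then k < p(h(x)), so that x ∈ ∅′ can be decided from A by waiting
-- until stage p(h(x)).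
--
-- The Turing machines needed are obtained by compiling primitive recursive
-- functions with an oracle, followed by a single unbounded search, first to
-- counter programs and then to machines whose tape carries one track per
-- counter.  The simulation of an arbitrary machine is primitive recursive.

module Submission where

open import Axiom.ExcludedMiddle using (ExcludedMiddle)
open import Data.Bool.Base using (Bool; true; false; not; _∧_; if_then_else_)
import Data.Bool.Properties as Bool
open import Data.Empty using (⊥-elim)
open import Data.List.Base using (List; []; _∷_; [_]; _++_; _ʳ++_; map; foldr; foldl; reverse; find; filter; length; replicate; upTo; cartesianProduct)
open import Data.List.Membership.Propositional using (_∈_)
open import Data.List.Membership.Propositional.Properties using (∈-map⁺; ∈-map⁻; ∈-++⁺ˡ; ∈-++⁺ʳ; ∈-++⁻; ∈-upTo⁺; ∈-upTo⁻; ∈-cartesianProduct⁺; ∈-cartesianProduct⁻)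
open import Data.List.Properties using (length-map; length-++; length-replicate; reverse-foldr; reverse-involutive; foldr-++; map-id)
open import Data.List.Relation.Unary.Any using (here; there)
open import Data.Maybe.Base using (Maybe; just; nothing; maybe′)
import Data.Maybe.Base as Maybe
open import Data.Nat.Base using (ℕ; zero; suc; pred; _+_; _∸_; _⊔_; _≡ᵇ_; _<ᵇ_; _<_; _≤_; z≤n; s≤s)
open import Data.Nat.GeneralisedArithmetic using (iterate)
import Data.Nat.Properties as ℕ
open import Data.Product.Base using (_×_; _,_; proj₁; proj₂; ∃-syntax; uncurry)
open import Data.Sum.Base using (_⊎_; inj₁; inj₂)
open import Function.Base using (_∘_; id)
open import Function.Bundles using (Equivalence; mk⇔; _⇔_)
open import Level using (0ℓ)
open import Relation.Binary.Bundles using (Setoid)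
open import Relation.Binary.PropositionalEquality using (_≡_; _≢_; refl; sym; trans; cong; cong₂; subst)
open import Relation.Nullary using (¬_; Dec; yes; no; does)
open import Relation.Nullary.Decidable using (decidable-stable)
open import Relation.Unary using (Decidable; Pred)
open import Defs

-- The self-reference in `h(x) ∼ gₖ(h(x))` is obtained without the recursion theorem. The function
-- to be totalized is the diagonal `⟨e, x⟩ ↦ φₑ(⟨e, x⟩)`, and its total extension `f` is fixed
-- before `e`. The program with code `e` receives `n = ⟨e, x⟩` as a whole, so it computes `f n`,
-- which is `h(x)`, from its input and never refers to its own code. If `x` enters at a stage
-- `k ≥ p(h(x))`, the approximation at stage `k` is already `g(h(x))`, and `h(x)` is a fixed point;
-- this forces `k < p(h(x))`. The modulus exists because the stages of an enumeration only grow: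
-- once a stage agrees with `A` on all cells that a halting computation can reach, so does every
-- later stage. The oracle `A` serves to recognise such a stage. Since approximations run an oracle
-- machine on computable stages in place of `A`, the simulation takes the simulated oracle as a
-- parameter, separate from the oracle of the simulating function.

-- Counter programs with an oracle head

data Cmd : Set where
  skip        : Cmd
  _⨾_         : Cmd → Cmd → Cmd
  inc ask     : ℕ → Cmd
  loop        : ℕ → Cmd → Cmd
  moveOracle  : Move → Cmd

infixr 5 _⨾_

-- One relation for reading, testing and writing a register: `Upd r 0 0 σ σ` is a test for zero, and
-- each instance asserts that register `r` exists.
data Upd : ℕ → ℕ → ℕ → List ℕ → List ℕ → Set where
  here  : ∀ {x y σ} → Upd 0 x y (x ∷ σ) (y ∷ σ)
  there : ∀ {r x y z σ τ} → Upd r x y σ τ → Upd (suc r) x y (z ∷ σ) (z ∷ τ)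

Store : Set
Store = List ℕ × ℕ

-- A loop decrements its register before each round. A body that leaves the register alone gives a
-- counted loop; a body that refills it gives an unbounded one.
data _⊢_⟨_⟩_ (χ : Oracle) : Store → Cmd → Store → Set where
  skip  : ∀ {s} → χ ⊢ s ⟨ skip ⟩ s
  _⨾_   : ∀ {c d s t u} → χ ⊢ s ⟨ c ⟩ t → χ ⊢ t ⟨ d ⟩ u → χ ⊢ s ⟨ c ⨾ d ⟩ u
  inc   : ∀ {r x σ τ o} → Upd r x (suc x) σ τ → χ ⊢ σ , o ⟨ inc r ⟩ (τ , o)
  exit  : ∀ {r c σ o} → Upd r 0 0 σ σ → χ ⊢ σ , o ⟨ loop r c ⟩ (σ , o)
  again : ∀ {r c x σ τ o t u} → Upd r (suc x) x σ τ → χ ⊢ τ , o ⟨ c ⟩ t →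
          χ ⊢ t ⟨ loop r c ⟩ u → χ ⊢ σ , o ⟨ loop r c ⟩ u
  moveOracle : ∀ {m σ o} → χ ⊢ σ , o ⟨ moveOracle m ⟩ (σ , shiftOracle m o)
  askYes : ∀ {r x σ τ o} → χ o ≡ true → Upd r x (suc x) σ τ → χ ⊢ σ , o ⟨ ask r ⟩ (τ , o)
  askNo  : ∀ {r σ o} → χ o ≡ false → χ ⊢ σ , o ⟨ ask r ⟩ (σ , o)

-- Tape symbols

double : ℕ → ℕ
double n = n + n

double-injective : ∀ {m n} → double m ≡ double n → m ≡ n
double-injective {zero}  {zero}  _ = refl
double-injective {suc m} {suc n} e =
  cong suc (double-injective (ℕ.suc-injective (ℕ.suc-injective
    (trans (cong suc (sym (ℕ.+-suc m m))) (trans e (cong suc (ℕ.+-suc n n)))))))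

even≢odd : ∀ {m n} → double m ≢ suc (double n)
even≢odd {suc m} {zero}  e with () ← trans (sym (ℕ.+-suc m m)) (ℕ.suc-injective e)
even≢odd {suc m} {suc n} e =
  even≢odd {m} {n} (ℕ.suc-injective (trans (sym (ℕ.+-suc m m)) (trans (ℕ.suc-injective e) (cong suc (ℕ.+-suc n n)))))

-- The empty column is the blank and a lone bit on track 0 is the stroke.
symbolOf : List Bool → Symbol
symbolOf []           = blank
symbolOf (false ∷ bs) = double (symbolOf bs)
symbolOf (true  ∷ bs) = suc (double (symbolOf bs))

-- The lengths have to agree because trailing `false` bits leave the number unchanged.
symbolOf-injective : ∀ {bs cs} → length bs ≡ length cs → symbolOf bs ≡ symbolOf cs → bs ≡ cs
symbolOf-injective {[]}         {[]}         _ _ = refl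
symbolOf-injective {false ∷ bs} {false ∷ cs} l e =
  cong (false ∷_) (symbolOf-injective (ℕ.suc-injective l) (double-injective e))
symbolOf-injective {false ∷ bs} {true ∷ cs}  l e = ⊥-elim (even≢odd {symbolOf bs} {symbolOf cs} e)
symbolOf-injective {true ∷ bs}  {false ∷ cs} l e = ⊥-elim (even≢odd {symbolOf cs} {symbolOf bs} (sym e))
symbolOf-injective {true ∷ bs}  {true ∷ cs}  l e =
  cong (true ∷_) (symbolOf-injective (ℕ.suc-injective l) (double-injective (ℕ.suc-injective e)))

allBits : ℕ → List (List Bool)
allBits zero    = [ [] ]
allBits (suc k) = map (false ∷_) (allBits k) ++ map (true ∷_) (allBits k)

∈-allBits⁺ : ∀ bs → bs ∈ allBits (length bs)
∈-allBits⁺ []           = here refl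
∈-allBits⁺ (false ∷ bs) = ∈-++⁺ˡ (∈-map⁺ (false ∷_) (∈-allBits⁺ bs))
∈-allBits⁺ (true ∷ bs)  = ∈-++⁺ʳ _ (∈-map⁺ (true ∷_) (∈-allBits⁺ bs))

∈-allBits⁻ : ∀ k {bs} → bs ∈ allBits k → length bs ≡ k
∈-allBits⁻ zero    (here refl) = refl
∈-allBits⁻ (suc k) p with ∈-++⁻ (map (false ∷_) (allBits k)) p
... | inj₁ q with _ , q′ , refl ← ∈-map⁻ (false ∷_) q = cong suc (∈-allBits⁻ k q′)
... | inj₂ q with _ , q′ , refl ← ∈-map⁻ (true ∷_) q = cong suc (∈-allBits⁻ k q′)

-- Programs from transition functions

record Action : Set where
  constructor action
  field
    write      : List Bool
    move       : Move
    oracleMove : Move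
    next       : State

TrackState : Set
TrackState = List Bool → Bool → Action

look : List TrackState → State → Maybe TrackState
look []       _       = nothing
look (μ ∷ _)  zero    = just μ
look (_ ∷ Γ)  (suc q) = look Γ q

look⇒< : ∀ Γ q {μ} → look Γ q ≡ just μ → q < length Γ
look⇒< (_ ∷ _) zero    _ = s≤s z≤n
look⇒< (_ ∷ Γ) (suc q) e = s≤s (look⇒< Γ q e)

-- A filler for the partial `look`: `keys` lists only states below `length Γ`, so no assembled
-- instruction comes from it.
idle : TrackState
idle bs _ = action bs stay stay 0

instructionAt : List TrackState → State × List Bool × Bool → Instruction
instructionAt Γ (q , bs , b) = instruction q (symbolOf bs) b next (symbolOf write) move oracleMove
  where open Action (Maybe.fromMaybe idle (look Γ q) bs b)

keys : ℕ → ℕ → List (State × List Bool × Bool)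
keys N k = cartesianProduct (upTo N) (cartesianProduct (allBits k) (false ∷ true ∷ []))

assemble : ℕ → List TrackState → Program
assemble k Γ = map (instructionAt Γ) (keys (length Γ) k)

find-just : ∀ {A : Set} {P : A → Set} (P? : Decidable P) {x} xs → x ∈ xs → P x →
            (∀ y → y ∈ xs → P y → y ≡ x) → find P? xs ≡ just x
find-just P? {x} (y ∷ xs) x∈ px uniq with P? y
... | yes py = cong just (uniq y (here refl) py)
... | no ¬py with x∈
...   | here refl = ⊥-elim (¬py px)
...   | there x∈′ = find-just P? xs x∈′ px (λ z z∈ → uniq z (there z∈))

find-nothing : ∀ {A : Set} {P : A → Set} (P? : Decidable P) xs →
               (∀ y → y ∈ xs → ¬ P y) → find P? xs ≡ nothing
find-nothing P? []       none = refl
find-nothing P? (y ∷ xs) none with P? y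
... | yes py = ⊥-elim (none y (here refl) py)
... | no _   = find-nothing P? xs (λ z z∈ → none z (there z∈))

bool∈ : ∀ b → b ∈ (false ∷ true ∷ [])
bool∈ false = here refl
bool∈ true  = there (here refl)

∈-assemble⁻ : ∀ {k Γ I q s b} → I ∈ assemble k Γ → Applies q s b I →
              ∃[ bs ] q < length Γ × length bs ≡ k × symbolOf bs ≡ s × I ≡ instructionAt Γ (q , bs , b)
∈-assemble⁻ {k} {Γ} I∈ (refl , refl , refl)
  with (q′ , bs′ , b′) , key∈ , refl ← ∈-map⁻ (instructionAt Γ) I∈
  with q∈ , rest∈ ← ∈-cartesianProduct⁻ (upTo (length Γ)) _ key∈
  with bs∈ , _ ← ∈-cartesianProduct⁻ (allBits k) _ rest∈
  = bs′ , ∈-upTo⁻ q∈ , ∈-allBits⁻ k bs∈ , refl , refl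

-- The first applicable instruction is the intended one because no other applies: among columns of
-- length `k`, the scanned symbol determines the column.
step-assemble : ∀ {χ k Γ q μ bs T o} → look Γ q ≡ just μ → length bs ≡ k → Tape.scanned T ≡ symbolOf bs →
                step χ (assemble k Γ) (config q T o) ≡
                just (execute (config q T o) (instructionAt Γ (q , bs , χ o)))
step-assemble {χ} {k} {Γ} {q} {μ} {bs} {T} {o} look≡ refl scanned≡ =
  cong (Maybe.map (execute (config q T o)))
    (find-just (applies? q (Tape.scanned T) (χ o)) (assemble k Γ)
      (∈-map⁺ (instructionAt Γ)
        (∈-cartesianProduct⁺ (∈-upTo⁺ (look⇒< Γ q look≡)) (∈-cartesianProduct⁺ (∈-allBits⁺ bs) (bool∈ (χ o)))))
      (refl , sym scanned≡ , refl)
      unique)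
  where
  unique : ∀ I → I ∈ assemble k Γ → Applies q (Tape.scanned T) (χ o) I → I ≡ instructionAt Γ (q , bs , χ o)
  unique I I∈ app with ∈-assemble⁻ {k} {Γ} I∈ app
  ... | bs′ , _ , l , e , refl with refl ← symbolOf-injective {bs′} {bs} l (trans e scanned≡) = refl

-- All instructions belong to states below `length Γ`, which makes that number the halting state.
halted-assemble : ∀ {χ k Γ T o} → step χ (assemble k Γ) (config (length Γ) T o) ≡ nothing
halted-assemble {χ} {k} {Γ} {T} {o} =
  cong (Maybe.map _) (find-nothing (applies? (length Γ) (Tape.scanned T) (χ o)) (assemble k Γ) none)
  where
  none : ∀ I → I ∈ assemble k Γ → ¬ Applies (length Γ) (Tape.scanned T) (χ o) I
  none I I∈ app with _ , q<N , _ ← ∈-assemble⁻ {k} {Γ} I∈ app = ℕ.<-irrefl refl q<N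

-- Stores on tracks

-- Unary notation: a register with value `x` marks exactly the cells `0` to `x - 1` of its track, so
-- an increment or decrement changes a single bit.
column : List ℕ → ℕ → List Bool
column σ j = map (j <ᵇ_) σ

track : ℕ → List Bool → Bool
track _       []       = false
track zero    (b ∷ _)  = b
track (suc r) (_ ∷ bs) = track r bs

setTrack : ℕ → Bool → List Bool → List Bool
setTrack _       _ []       = []
setTrack zero    b (_ ∷ bs) = b ∷ bs
setTrack (suc r) b (c ∷ bs) = c ∷ setTrack r b bs

cell : List Symbol → ℕ → Symbol
cell []       _       = blank
cell (s ∷ _)  zero    = s
cell (_ ∷ ss) (suc j) = cell ss j

cells : Tape → List Symbol
cells (tape ls s rs) = ls ʳ++ (s ∷ rs)

-- Positions are counted from the far end of `before`, so cell 0 is the cell on which the machine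
-- starts; the cells to its left are never visited.
record Rep (σ : List ℕ) (j : ℕ) (T : Tape) : Set where
  constructor rep
  field
    position : length (Tape.before T) ≡ j
    contents : ∀ i → cell (cells T) i ≡ symbolOf (column σ i)

cell-ʳ++ : ∀ ls {rs rs′} → (∀ i → cell rs i ≡ cell rs′ i) → ∀ i → cell (ls ʳ++ rs) i ≡ cell (ls ʳ++ rs′) i
cell-ʳ++ []       e = e
cell-ʳ++ (l ∷ ls) e = cell-ʳ++ ls λ { zero → refl ; (suc i) → e i }

cell-length : ∀ ls {s rs} → cell (ls ʳ++ (s ∷ rs)) (length ls) ≡ s
cell-length ls {s} {rs} = trans (cong (cell (ls ʳ++ (s ∷ rs))) (sym (ℕ.+-identityʳ _))) (go ls 0)
  where
  go : ∀ ls {rs} j → cell (ls ʳ++ rs) (length ls + j) ≡ cell rs j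
  go []       j = refl
  go (l ∷ ls) {rs} j = trans (cong (cell (ls ʳ++ (l ∷ rs))) (sym (ℕ.+-suc (length ls) j))) (go ls (suc j))

cell-print : ∀ ls {s s′ rs} i → i ≢ length ls → cell (ls ʳ++ (s ∷ rs)) i ≡ cell (ls ʳ++ (s′ ∷ rs)) i
cell-print ls i ne = go ls i (λ e → ne (trans e (ℕ.+-identityʳ _)))
  (λ { zero n0 → ⊥-elim (n0 refl) ; (suc _) _ → refl })
  where
  go : ∀ ls {rs rs′ j} i → i ≢ length ls + j → (∀ k → k ≢ j → cell rs k ≡ cell rs′ k) →
       cell (ls ʳ++ rs) i ≡ cell (ls ʳ++ rs′) i
  go []       i ne e = e i ne
  go (l ∷ ls) {j = j} i ne e = go ls i (λ p → ne (trans p (ℕ.+-suc (length ls) j)))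
    λ { zero _ → refl ; (suc k) ne′ → e k (ne′ ∘ cong suc) }

scanned-rep : ∀ {σ j T} → Rep σ j T → Tape.scanned T ≡ symbolOf (column σ j)
scanned-rep {T = tape ls s rs} (rep refl e) = trans (sym (cell-length ls)) (e (length ls))

shift-right-rep : ∀ {σ j T} → Rep σ j T → Rep σ (suc j) (shift right T)
shift-right-rep {T = tape ls s []} (rep refl e) =
  rep refl λ i → trans (cell-ʳ++ ls (λ { zero → refl ; (suc zero) → refl ; (suc (suc _)) → refl }) i) (e i)
shift-right-rep {T = tape ls s (r ∷ rs)} (rep refl e) = rep refl e

shift-left-rep : ∀ {σ j T} → Rep σ (suc j) T → Rep σ j (shift left T)
shift-left-rep {T = tape (l ∷ ls) s rs} (rep refl e) = rep refl e

print-rep : ∀ {σ τ j T} → Rep σ j T → (∀ i → i ≢ j → column σ i ≡ column τ i) →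
            Rep τ j (print (symbolOf (column τ j)) T)
print-rep {σ} {τ} {T = tape ls s rs} (rep refl e) same = rep refl go
  where
  go : ∀ i → cell (ls ʳ++ (symbolOf (column τ (length ls)) ∷ rs)) i ≡ symbolOf (column τ i)
  go i with i ℕ.≟ length ls
  ... | yes refl = cell-length ls
  ... | no ne = trans (cell-print ls i ne) (trans (e i) (cong symbolOf (same i ne)))

print-scanned-rep : ∀ {σ j T} → Rep σ j T → print (symbolOf (column σ j)) T ≡ T
print-scanned-rep {T = T} R = cong (λ s → tape (Tape.before T) s (Tape.after T)) (sym (scanned-rep R))

track-upd : ∀ {r x y σ τ} → Upd r x y σ τ → ∀ j → track r (column σ j) ≡ (j <ᵇ x)
track-upd here      j = refl
track-upd (there u) j = track-upd u j

setTrack-upd : ∀ {r x y σ τ} → Upd r x y σ τ → ∀ j → setTrack r (j <ᵇ y) (column σ j) ≡ column τ j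
setTrack-upd here      j = refl
setTrack-upd (there u) j = cong (_ ∷_) (setTrack-upd u j)

column-upd : ∀ {r x y σ τ} → Upd r x y σ τ → ∀ j → (j <ᵇ x) ≡ (j <ᵇ y) → column σ j ≡ column τ j
column-upd (here {σ = σ}) j e = cong (_∷ column σ j) e
column-upd (there u) j e = cong (_ ∷_) (column-upd u j e)

upd-length : ∀ {r x y σ τ} → Upd r x y σ τ → length σ ≡ length τ
upd-length here      = refl
upd-length (there u) = cong suc (upd-length u)

<ᵇ-suc : ∀ j x → j ≢ x → (j <ᵇ x) ≡ (j <ᵇ suc x)
<ᵇ-suc zero    zero    ne = ⊥-elim (ne refl)
<ᵇ-suc zero    (suc x) ne = refl
<ᵇ-suc (suc j) zero    ne = refl
<ᵇ-suc (suc j) (suc x) ne = <ᵇ-suc j x (ne ∘ cong suc)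

n<ᵇn : ∀ n → (n <ᵇ n) ≡ false
n<ᵇn zero    = refl
n<ᵇn (suc n) = n<ᵇn n

n<ᵇ1+n+m : ∀ n m → (n <ᵇ suc (n + m)) ≡ true
n<ᵇ1+n+m zero    m = refl
n<ᵇ1+n+m (suc n) m = n<ᵇ1+n+m n m

-- Compilation

branch : ℕ → (Move × State) → (Move × State) → TrackState
branch r (m , q) (m′ , q′) bs _ =
  if track r bs then action bs m stay q else action bs m′ stay q′

writeTrack : ℕ → Bool → State → TrackState
writeTrack r b q bs _ = action (setTrack r b bs) stay stay q

-- Track 1 carries a single bit, in cell 0, by which the machine finds its way
-- home; the registers occupy the other tracks.
homing : State → TrackState
homing p = branch 1 (stay , suc p) (left , p)

askOracle : State → State → TrackState
askOracle q q′ bs b = action bs stay stay (if b then q else q′)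

jump : Move → State → TrackState
jump m q bs _ = action bs stay m q

-- Register 0 keeps track 0, on which a lone mark is a stroke, so that input and output need no
-- translation.
slot : ℕ → ℕ
slot zero    = 0
slot (suc r) = 2 + r

-- The home mark is treated as one more register, of value 1, so that the lemmas on registers apply
-- to it.
withHome : List ℕ → List ℕ
withHome []      = 0 ∷ 1 ∷ []
withHome (x ∷ σ) = x ∷ 1 ∷ σ

compileInc : ℕ → State → List TrackState
compileInc r p =
  branch (slot r) (right , p) (stay , 1 + p) ∷ writeTrack (slot r) true (2 + p) ∷ homing (2 + p) ∷ []

-- The summands for `c ⨾ d` are reversed so that `size (c ⨾ d) + p` reassociates to the exit state
-- of `d` placed at `size c + p`.
size : Cmd → ℕ
size skip           = 0
size (c ⨾ d)        = size d + size c
size (inc r)        = 3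
size (ask r)        = 4
size (loop r c)     = 5 + size c
size (moveOracle m) = 1

-- Each command starts and ends with the work head on cell 0. A register is zero exactly when cell 0
-- of its track is unmarked, so the loop test is made on the spot; the decrement erases the mark to
-- the left of the first free cell.
compile : Cmd → State → List TrackState
compile skip           p = []
compile (c ⨾ d)        p = compile c p ++ compile d (size c + p)
compile (inc r)        p = compileInc r p
compile (ask r)        p = askOracle (1 + p) (4 + p) ∷ compileInc r (1 + p)
compile (loop r c)     p =
  branch (slot r) (stay , 1 + p) (stay , size (loop r c) + p) ∷
  branch (slot r) (right , 1 + p) (left , 2 + p) ∷
  writeTrack (slot r) false (3 + p) ∷
  homing (3 + p) ∷
  compile c (4 + p) ++ [ jump stay p ]
compile (moveOracle m) p = [ jump m (1 + p) ]

length-compile : ∀ c p → length (compile c p) ≡ size c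
length-compile skip           p = refl
length-compile (c ⨾ d)        p =
  trans (length-++ (compile c p))
    (trans (cong₂ _+_ (length-compile c p) (length-compile d _)) (ℕ.+-comm (size c) (size d)))
length-compile (inc r)        p = refl
length-compile (ask r)        p = refl
length-compile (loop r c)     p =
  cong (4 +_) (trans (length-++ (compile c (4 + p)))
    (trans (cong (_+ 1) (length-compile c _)) (ℕ.+-comm (size c) 1)))
length-compile (moveOracle m) p = refl

-- Correctness of compilation

At : List TrackState → State → List TrackState → Set
At Γ p Δ = ∀ q μ → look Δ q ≡ just μ → look Γ (q + p) ≡ just μ

at-++ˡ : ∀ Γ p Δ {Θ} → At Γ p (Δ ++ Θ) → At Γ p Δ
at-++ˡ Γ p Δ at q μ e = at q μ (look-++ Δ q e)
  where
  look-++ : ∀ Δ q {Θ μ} → look Δ q ≡ just μ → look (Δ ++ Θ) q ≡ just μ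
  look-++ (_ ∷ _) zero    e = e
  look-++ (_ ∷ Δ) (suc q) e = look-++ Δ q e

look-++ʳ : ∀ Δ {Θ} q → look (Δ ++ Θ) (q + length Δ) ≡ look Θ q
look-++ʳ []      {Θ} q = cong (look Θ) (ℕ.+-identityʳ q)
look-++ʳ (μ ∷ Δ) {Θ} q = trans (cong (look (μ ∷ Δ ++ Θ)) (ℕ.+-suc q (length Δ))) (look-++ʳ Δ q)

at-++ʳ : ∀ Γ p Δ {Θ} → At Γ p (Δ ++ Θ) → At Γ (length Δ + p) Θ
at-++ʳ Γ p Δ at q μ e =
  trans (cong (look Γ) (sym (ℕ.+-assoc q (length Δ) p))) (at (q + length Δ) μ (trans (look-++ʳ Δ q) e))

infix 4 _,_⊢_⟶*_
data _,_⊢_⟶*_ (χ : Oracle) (P : Program) : Configuration → Configuration → Set where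
  done : ∀ {C} → χ , P ⊢ C ⟶* C
  _then_ : ∀ {C C′ D} → step χ P C ≡ just C′ → χ , P ⊢ C′ ⟶* D → χ , P ⊢ C ⟶* D

infixr 5 _then_ _⋯_
_⋯_ : ∀ {χ P C D E} → χ , P ⊢ C ⟶* D → χ , P ⊢ D ⟶* E → χ , P ⊢ C ⟶* E
done       ⋯ r = r
(e then r) ⋯ r′ = e then (r ⋯ r′)

⟶*⇒⇓ : ∀ {χ P C D} → χ , P ⊢ C ⟶* D → step χ P D ≡ nothing → χ , P ⊢ C ⇓ D
⟶*⇒⇓ done       h = halt h
⟶*⇒⇓ (e then r) h = run e (⟶*⇒⇓ r h)

upd-withHome : ∀ {r x y σ τ} → Upd r x y σ τ → Upd (slot r) x y (withHome σ) (withHome τ)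
upd-withHome here              = here
upd-withHome (there here)      = there (there here)
upd-withHome (there (there u)) = there (there (there u))

home-track : ∀ σ j → track 1 (column (withHome σ) j) ≡ (j <ᵇ 1)
home-track []      j = refl
home-track (x ∷ σ) j = refl

module Simulation (χ : Oracle) (k : ℕ) (Γ : List TrackState) where

  P : Program
  P = assemble k Γ

  perform : Action → Configuration → Configuration
  perform (action bs m om q) (config _ T o) = config q (shift m (print (symbolOf bs) T)) (shiftOracle om o)

  step-track : ∀ {q μ σ j T o} → look Γ q ≡ just μ → length σ ≡ k → Rep σ j T →
               step χ P (config q T o) ≡ just (perform (μ (column σ j) (χ o)) (config q T o))
  step-track {q} {μ} {σ} {j} {T} {o} e l R =
    trans (step-assemble {χ} {k} {Γ} {q} {o = o} e (trans (length-map (j <ᵇ_) σ) l) (scanned-rep R))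
      (cong (λ m → just (perform (Maybe.fromMaybe idle m (column σ j) (χ o)) (config q T o))) e)

  step-branch : ∀ {q r m m′ p p′ σ j T o} b → look Γ q ≡ just (branch r (m , p) (m′ , p′)) →
                length σ ≡ k → Rep σ j T → track r (column σ j) ≡ b →
                step χ P (config q T o) ≡
                just (config (if b then p else p′) (shift (if b then m else m′) T) o)
  step-branch {q} {r} {m} {m′} {p} {p′} {σ} {j} {T} {o} b e l R t =
    trans (step-track {o = o} e l R)
      (trans (cong (λ b → just (perform (if b then action bs m stay p else action bs m′ stay p′) (config q T o))) t) (go b))
    where
    bs : List Bool
    bs = column σ j
    go : ∀ b → just (perform (if b then action bs m stay p else action bs m′ stay p′) (config q T o)) ≡
               just (config (if b then p else p′) (shift (if b then m else m′) T) o)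
    go true  = cong (λ T → just (config p (shift m T) o)) (print-scanned-rep R)
    go false = cong (λ T → just (config p′ (shift m′ T) o)) (print-scanned-rep R)

  write-track : ∀ {q r b p σ τ j x y T o} → look Γ q ≡ just (writeTrack r b p) → length σ ≡ k →
                Rep σ j T → Upd r x y σ τ → b ≡ (j <ᵇ y) → (∀ i → i ≢ j → (i <ᵇ x) ≡ (i <ᵇ y)) →
                ∃[ T′ ] step χ P (config q T o) ≡ just (config p T′ o) × Rep τ j T′
  write-track {r = r} {σ = σ} {τ} {j} {x} {y} {T} {o} e l R u refl same =
    -- `perform` discards the old state, so 0 may stand for it.
    _ , trans (step-track {o = o} e l R) (cong (λ bs → just (perform (action bs stay stay _) (config 0 T o))) (setTrack-upd u j)) ,
    print-rep R (λ i ne → column-upd u i (same i ne))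

  walk-home : ∀ {p σ} j {T o} → look Γ p ≡ just (homing p) → length (withHome σ) ≡ k → Rep (withHome σ) j T →
              ∃[ T′ ] χ , P ⊢ config p T o ⟶* config (suc p) T′ o × Rep (withHome σ) 0 T′
  walk-home {p} {σ} zero e l R = _ , (step-branch true e l R (home-track σ 0) then done) , R
  walk-home {p} {σ} (suc j) e l R
    with T′ , r , R′ ← walk-home {p} {σ} j e l (shift-left-rep R)
    = T′ , (step-branch false e l R (home-track σ (suc j)) then r) , R′

  -- The recursion is on `d`, the number of marks still to be passed from position `j`. The last
  -- step already makes the move `m`, hence `shift m` around a tape whose head is on the first free
  -- cell.
  walk-right : ∀ {p r m q σ τ x y} d j {T o} → look Γ p ≡ just (branch r (right , p) (m , q)) →
               length σ ≡ k → Upd r x y σ τ → j + d ≡ x → Rep σ j T →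
               ∃[ T′ ] χ , P ⊢ config p T o ⟶* config q (shift m T′) o × Rep σ x T′
  walk-right zero j e l u j≡x R with refl ← trans (sym (ℕ.+-identityʳ j)) j≡x =
    _ , (step-branch false e l R (trans (track-upd u j) (n<ᵇn j)) then done) , R
  walk-right (suc d) j e l u refl R
    with T′ , r , R′ ← walk-right d (suc j) e l u (sym (ℕ.+-suc j d)) (shift-right-rep R)
    = T′ , (step-branch true e l R (trans (track-upd u j) (trans (cong (j <ᵇ_) (ℕ.+-suc j d)) (n<ᵇ1+n+m j d))) then r) , R′

  inc-correct : ∀ {r p σ τ x T o} → At Γ p (compileInc r p) → length (withHome σ) ≡ k → Rep (withHome σ) 0 T →
                Upd r x (suc x) σ τ →
                ∃[ T′ ] χ , P ⊢ config p T o ⟶* config (3 + p) T′ o × Rep (withHome τ) 0 T′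
  inc-correct {τ = τ} {x} at l R u
    with T₁ , r₁ , R₁ ← walk-right x 0 (at 0 _ refl) l (upd-withHome u) refl R
    with T₂ , s₂ , R₂ ← write-track (at 1 _ refl) l R₁ (upd-withHome u)
           (sym (trans (cong (λ z → x <ᵇ suc z) (sym (ℕ.+-identityʳ x))) (n<ᵇ1+n+m x 0))) (λ i → <ᵇ-suc i x)
    with T₃ , r₃ , R₃ ← walk-home {σ = τ} x (at 2 _ refl) (trans (sym (upd-length (upd-withHome u))) l) R₂
    = T₃ , (r₁ ⋯ s₂ then r₃) , R₃

  body-at : ∀ r c p → At Γ p (compile (loop r c) p) → At Γ (4 + p) (compile c (4 + p) ++ [ jump stay p ])
  body-at r c p at q μ e = trans (cong (look Γ) 4+) (at (4 + q) μ e)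
    where
    4+ : q + (4 + p) ≡ 4 + (q + p)
    4+ = trans (ℕ.+-comm q (4 + p)) (cong (4 +_) (ℕ.+-comm p q))

  jump-at : ∀ r c p → At Γ p (compile (loop r c) p) → look Γ (size c + (4 + p)) ≡ just (jump stay p)
  jump-at r c p at =
    subst (λ n → look Γ (n + (4 + p)) ≡ just (jump stay p)) (length-compile c (4 + p))
      (at-++ʳ Γ (4 + p) (compile c (4 + p)) (body-at r c p at) 0 _ refl)

  -- The induction is on the execution, not on the command: after the final `jump`, a loop is run
  -- again from the same state `p`.
  correct : ∀ {c p σ τ T o o′} → χ ⊢ σ , o ⟨ c ⟩ (τ , o′) → At Γ p (compile c p) →
            length (withHome σ) ≡ k → Rep (withHome σ) 0 T →
            ∃[ T′ ] χ , P ⊢ config p T o ⟶* config (size c + p) T′ o′ × Rep (withHome τ) 0 T′ × length (withHome τ) ≡ k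
  correct skip at l R = _ , done , R , l
  correct {c ⨾ d} {p} {o′ = o′} (_⨾_ {t = _ , o₁} E E′) at l R
    with T₁ , r₁ , R₁ , l₁ ← correct E (at-++ˡ Γ p (compile c p) at) l R
    with T₂ , r₂ , R₂ , l₂ ← correct E′
           (subst (λ n → At Γ (n + p) (compile d (size c + p))) (length-compile c p) (at-++ʳ Γ p (compile c p) at)) l₁ R₁
    = T₂ , (r₁ ⋯ subst (λ n → χ , P ⊢ config (size c + p) T₁ o₁ ⟶* config n T₂ o′)
             (sym (ℕ.+-assoc (size d) (size c) p)) r₂) , R₂ , l₂
  correct (inc u) at l R
    with T₁ , r₁ , R₁ ← inc-correct at l R u
    = T₁ , r₁ , R₁ , trans (sym (upd-length (upd-withHome u))) l
  correct (exit u) at l R =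
    _ , (step-branch false (at 0 _ refl) l R (track-upd (upd-withHome u) 0) then done) , R , l
  correct {loop r c} {p} (again {x = x} {τ = τ₁} {t = _ , _} u E E′) at l R
    with T₁ , r₁ , R₁ ← walk-right _ 0 (at 1 _ refl) l (upd-withHome u) refl R
    -- The register holds `suc x`, so its last mark is in cell `x`, one to the left of the first
    -- free cell.
    with T₂ , s₂ , R₂ ← write-track (at 2 _ refl) l (shift-left-rep R₁) (upd-withHome u) (sym (n<ᵇn x))
           (λ i ne → sym (<ᵇ-suc i x ne))
    with T₃ , r₃ , R₃ ← walk-home {σ = τ₁} _ (at 3 _ refl) (trans (sym (upd-length (upd-withHome u))) l) R₂
    with T₄ , r₄ , R₄ , l₄ ← correct {c} {4 + p} E (at-++ˡ Γ (4 + p) (compile c (4 + p)) (body-at r c p at))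
           (trans (sym (upd-length (upd-withHome u))) l) R₃
    with T₅ , r₅ , R₅ , l₅ ← correct E′ at l₄ R₄
    = T₅ , (step-branch true (at 0 _ refl) l R (track-upd (upd-withHome u) 0) then
           (r₁ ⋯ s₂ then r₃ ⋯ r₄ ⋯
            trans (step-track (jump-at r c p at) l₄ R₄) (cong (λ T → just (config p T _)) (print-scanned-rep R₄)) then
            r₅)) , R₅ , l₅
  correct {p = p} {o = o} (moveOracle {m}) at l R =
    _ , (trans (step-track (at 0 _ refl) l R) 
           (cong (λ T → just (config (1 + p) T (shiftOracle m o))) (print-scanned-rep R)) then done) , R , l
  correct {ask r} {p} {o = o} (askYes e u) at l R
    with T₁ , r₁ , R₁ ← inc-correct {r} {1 + p} {o = o}
           (λ q μ e → trans (cong (look Γ) (ℕ.+-suc q p)) (at (suc q) μ e)) l R u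
    = T₁ , (trans (step-track (at 0 _ refl) l R)
           (cong₂ (λ b T → just (config (if b then suc p else 4 + p) T o)) e (print-scanned-rep R)) then r₁) ,
      R₁ , trans (sym (upd-length (upd-withHome u))) l
  correct {ask r} {p} {o = o} (askNo e) at l R =
    _ , (trans (step-track (at 0 _ refl) l R)
           (cong₂ (λ b T → just (config (if b then suc p else 4 + p) T o)) e (print-scanned-rep R)) then done) , R , l

-- The complete machine with its input and output

trackProgram : Cmd → List TrackState
trackProgram c = writeTrack 1 true 1 ∷ compile c 1 ++ [ writeTrack 1 false (2 + size c) ]

machine : ℕ → Cmd → Program
machine m c = assemble (2 + m) (trackProgram c)

symbolOf-zeros : ∀ m i → symbolOf (column (replicate m 0) i) ≡ 0
symbolOf-zeros zero    i = refl
symbolOf-zeros (suc m) i = cong double (symbolOf-zeros m i)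

symbolOf-unary : ∀ x m i → symbolOf (column (x ∷ replicate m 0) i) ≡ bit (i <ᵇ x)
symbolOf-unary x m i with i <ᵇ x
... | true  = cong (suc ∘ double) (symbolOf-zeros m i)
... | false = cong double (symbolOf-zeros m i)

initial-rep : ∀ n m → Rep (suc n ∷ replicate m 0) 0 (Configuration.work (initial n))
initial-rep n m = rep refl λ i → trans (strokes (suc n) i) (sym (symbolOf-unary (suc n) m i))
  where
  strokes : ∀ n i → cell (replicate n stroke) i ≡ bit (i <ᵇ n)
  strokes zero    i       = refl
  strokes (suc n) zero    = refl
  strokes (suc n) (suc i) = strokes n i

count-strokes : ∀ ss x → (∀ i → cell ss i ≡ bit (i <ᵇ x)) → length (filter (ℕ._≟ stroke) ss) ≡ x
count-strokes []       zero    e = refl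
count-strokes []       (suc x) e with () ← e 0
count-strokes (s ∷ ss) zero    e with refl ← e 0 = count-strokes ss zero (e ∘ suc)
count-strokes (s ∷ ss) (suc x) e with refl ← e 0 = cong suc (count-strokes ss x (e ∘ suc))

output-rep : ∀ {x m q T o} → Rep (x ∷ replicate m 0) 0 T → output (config q T o) ≡ x
output-rep {x} {m} {T = tape [] s rs} R =
  count-strokes (s ∷ rs) x λ i → trans (Rep.contents R i) (symbolOf-unary x m i)

-- Register 0 starts at `suc n` because the input is a block of `n + 1` strokes. The home mark is
-- erased at the end since a symbol with a bit on track 1 is not counted as a stroke.
machine-outputs : ∀ {χ c n m x o} → χ ⊢ (suc n ∷ replicate m 0 , 0) ⟨ c ⟩ (x ∷ replicate m 0 , o) →
                  Outputs χ (machine m c) n x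
machine-outputs {χ} {c} {n} {m} {x} {o} E = outputs
  where
  Γ : List TrackState
  Γ = trackProgram c
  open Simulation χ (2 + m) Γ
  at : At Γ 1 (compile c 1 ++ [ writeTrack 1 false (2 + size c) ])
  at q μ e = trans (cong (look Γ) (ℕ.+-comm q 1)) e
  look-last : look Γ (size c + 1) ≡ just (writeTrack 1 false (2 + size c))
  look-last = subst (λ n → look Γ (n + 1) ≡ just (writeTrack 1 false (2 + size c)))
    (length-compile c 1) (at-++ʳ Γ 1 (compile c 1) at 0 _ refl)
  length-Γ : length Γ ≡ 2 + size c
  length-Γ = cong suc (trans (length-++ (compile c 1)) (trans (cong (_+ 1) (length-compile c 1)) (ℕ.+-comm (size c) 1)))
  outputs : Outputs χ (machine m c) n x
  outputs
    with T₁ , s₁ , R₁ ← write-track {q = 0} {o = 0} refl (cong (2 +_) (length-replicate m)) (initial-rep n (suc m))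
                          (there (here {x = 0} {y = 1})) refl (λ { zero ne → ⊥-elim (ne refl) ; (suc _) _ → refl })
    with T₂ , r₂ , R₂ , l₂ ← correct E (at-++ˡ Γ 1 (compile c 1) at) (cong (2 +_) (length-replicate m)) R₁
    with T₃ , s₃ , R₃ ← write-track {q = size c + 1} {o = o} look-last l₂ R₂ (there (here {x = 1} {y = 0})) refl
                          (λ { zero ne → ⊥-elim (ne refl) ; (suc _) _ → refl })
    = config (2 + size c) T₃ o , ⟶*⇒⇓ (s₁ then (r₂ ⋯ s₃ then done))
            (subst (λ q → step χ (machine m c) (config q T₃ o) ≡ nothing) length-Γ (halted-assemble {χ} {2 + m} {Γ})) ,
      output-rep {x} {suc m} {2 + size c} {T₃} {o} R₃

-- The inverse of Cantor's pairing function

-- Successor along Cantor's diagonals: `y` grows within a diagonal, and the end `(0 , y)` of one is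
-- followed by the start `(suc y , 0)` of the next.
next : ℕ × ℕ → ℕ × ℕ
next (zero  , y) = suc y , 0
next (suc x , y) = x , suc y

unpair : ℕ → ℕ × ℕ
unpair zero    = 0 , 0
unpair (suc n) = next (unpair n)

pair-next : ∀ p → uncurry pair (next p) ≡ suc (uncurry pair p)
pair-next (zero  , y) =
  trans (ℕ.+-identityʳ _) (trans (cong triangle (ℕ.+-identityʳ (suc y))) (cong suc (ℕ.+-comm y (triangle y))))
pair-next (suc x , y) = trans (cong (λ s → triangle s + suc y) (ℕ.+-suc x y)) (ℕ.+-suc (triangle (suc x + y)) y)

pair-unpair : ∀ n → uncurry pair (unpair n) ≡ n
pair-unpair zero    = refl
pair-unpair (suc n) = trans (pair-next (unpair n)) (cong suc (pair-unpair n))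

-- Induction on the diagonal `x + y` and, within it, on `y`, which counts the applications of `next`
-- since the diagonal began.
unpair-pair : ∀ x y → unpair (pair x y) ≡ (x , y)
unpair-pair x y = diagonal (x + y) x y refl
  where
  diagonal : ∀ s x y → x + y ≡ s → unpair (pair x y) ≡ (x , y)
  diagonal zero    zero    zero    _ = refl
  diagonal (suc s) (suc x) zero    e =
    trans (cong unpair (trans (cong (λ x → triangle x + 0) (ℕ.+-identityʳ (suc x)))
            (trans (ℕ.+-identityʳ _) (cong suc (ℕ.+-comm x (triangle x))))))
          (cong next (diagonal s zero x (trans (sym (ℕ.+-identityʳ x)) (ℕ.suc-injective e))))
  diagonal s       x       (suc y) e =
    trans (cong unpair (pair-next (suc x , y)))
          (cong next (diagonal s (suc x) y (trans (sym (ℕ.+-suc x y)) e)))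

-- Primitive recursion with an oracle

infixr 9 _∙_

-- Pairing reduces everything to unary functions. Iteration takes the place of the recursion scheme
-- because it is what a counted loop computes; its argument pairs the number of rounds with the
-- initial value.
data PR : Set where
  `id `zero `suc `fst `snd `query : PR
  ⟨_,_⟩ _∙_ : PR → PR → PR
  `iterate : PR → PR

⟦_⟧ : PR → Oracle → ℕ → ℕ
⟦ `id ⟧        χ n = n
⟦ `zero ⟧      χ n = 0
⟦ `suc ⟧       χ n = suc n
⟦ `fst ⟧       χ n = proj₁ (unpair n)
⟦ `snd ⟧       χ n = proj₂ (unpair n)
⟦ `query ⟧     χ n = bit (χ n)
⟦ ⟨ f , g ⟩ ⟧  χ n = pair (⟦ f ⟧ χ n) (⟦ g ⟧ χ n)
⟦ f ∙ g ⟧      χ n = ⟦ f ⟧ χ (⟦ g ⟧ χ n)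
⟦ `iterate f ⟧ χ n = iterate (⟦ f ⟧ χ) (proj₂ (unpair n)) (proj₁ (unpair n))

-- Counter programs

shiftCmd : Cmd → Cmd
shiftCmd skip           = skip
shiftCmd (c ⨾ d)        = shiftCmd c ⨾ shiftCmd d
shiftCmd (inc r)        = inc (suc r)
shiftCmd (ask r)        = ask (suc r)
shiftCmd (loop r c)     = loop (suc r) (shiftCmd c)
shiftCmd (moveOracle m) = moveOracle m

shifted : ∀ {χ x σ τ c o o′} → χ ⊢ σ , o ⟨ c ⟩ (τ , o′) → χ ⊢ x ∷ σ , o ⟨ shiftCmd c ⟩ (x ∷ τ , o′)
shifted skip           = skip
shifted (_⨾_ {t = _ , _} E E′) = shifted E ⨾ shifted E′
shifted (inc u)        = inc (there u)
shifted (exit u)       = exit (there u)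
shifted (again {t = _ , _} u E E′) = again (there u) (shifted E) (shifted E′)
shifted moveOracle     = moveOracle
shifted (askYes e u)   = askYes e (there u)
shifted (askNo e)      = askNo e

iterate-commute : ∀ {A : Set} (f : A → A) x n → iterate f (f x) n ≡ f (iterate f x n)
iterate-commute f x zero    = refl
iterate-commute f x (suc n) = iterate-commute f (f x) n

iterate-suc : ∀ x n → iterate suc x n ≡ n + x
iterate-suc x zero    = refl
iterate-suc x (suc n) = trans (iterate-commute suc x n) (cong suc (iterate-suc x n))

-- `iterate` applies `f` to the initial value first, so it unfolds in step with the loop. The state
-- `a` may determine the oracle position as well, as it does for `query`.
for : ∀ {χ r c} {A : Set} (σ : ℕ → A → List ℕ) (o : A → ℕ) (f : A → A) →
      (∀ {x y a} → Upd r x y (σ x a) (σ y a)) →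
      (∀ n a → χ ⊢ σ n a , o a ⟨ c ⟩ (σ n (f a) , o (f a))) →
      ∀ n a → χ ⊢ σ n a , o a ⟨ loop r c ⟩ (σ 0 (iterate f a n) , o (iterate f a n))
for σ o f u body zero    a = exit u
for σ o f u body (suc n) a = again u (body n a) (for σ o f u body n (f a))

clear : ∀ {χ r o} (σ : ℕ → List ℕ) → (∀ {x y} → Upd r x y (σ x) (σ y)) → ∀ n →
        χ ⊢ σ n , o ⟨ loop r skip ⟩ (σ 0 , o)
clear σ u zero    = exit u
clear σ u (suc n) = again u skip (clear σ u n)

moveInto : ℕ → ℕ → Cmd
moveInto r s = loop r (inc s)

moves : ∀ {χ r s o} (σ : ℕ → ℕ → List ℕ) →
        (∀ {x y a} → Upd r x y (σ x a) (σ y a)) → (∀ {x a b} → Upd s a b (σ x a) (σ x b)) →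
        ∀ n a → χ ⊢ σ n a , o ⟨ moveInto r s ⟩ (σ 0 (n + a) , o)
moves {χ} {r} {s} {o} σ u v n a =
  subst (λ b → χ ⊢ σ n a , o ⟨ moveInto r s ⟩ (σ 0 b , o)) (iterate-suc a n)
    (for σ (λ _ → o) suc u (λ _ _ → inc v) n a)

infixr 6 _becomes_
_becomes_ : ∀ {χ s c τ τ′ o} → χ ⊢ s ⟨ c ⟩ (τ , o) → τ ≡ τ′ → χ ⊢ s ⟨ c ⟩ (τ′ , o)
E becomes refl = E

copyCmd : Cmd
copyCmd = loop 0 (inc 1 ⨾ inc 2) ⨾ moveInto 2 0

copies : ∀ {χ o} x σ → χ ⊢ x ∷ 0 ∷ 0 ∷ σ , o ⟨ copyCmd ⟩ (x ∷ x ∷ 0 ∷ σ , o)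
copies {o = o} x σ =
  for (λ n a → n ∷ a ∷ a ∷ σ) (λ _ → o) suc here (λ _ _ → inc (there here) ⨾ inc (there (there here))) x 0
  ⨾ moves (λ n a → a ∷ _ ∷ n ∷ σ) (there (there here)) here _ 0
  becomes cong₂ (λ a b → a ∷ b ∷ 0 ∷ σ) (trans (ℕ.+-identityʳ _) x≡) x≡
  where
  x≡ : iterate suc 0 x ≡ x
  x≡ = trans (iterate-suc 0 x) (ℕ.+-identityʳ x)

swapCmd : Cmd
swapCmd = moveInto 0 2 ⨾ moveInto 1 0 ⨾ moveInto 2 1

swaps : ∀ {χ o} x y σ → χ ⊢ x ∷ y ∷ 0 ∷ σ , o ⟨ swapCmd ⟩ (y ∷ x ∷ 0 ∷ σ , o)
swaps x y σ =
  (moves (λ n a → n ∷ y ∷ a ∷ σ) here (there (there here)) x 0)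
  ⨾ (moves (λ n a → a ∷ n ∷ _ ∷ σ) (there here) here y 0)
  ⨾ (moves (λ n a → _ ∷ a ∷ n ∷ σ) (there (there here)) (there here) (x + 0) 0)
  becomes cong₂ (λ a b → a ∷ b ∷ 0 ∷ σ) (ℕ.+-identityʳ y) (trans (ℕ.+-identityʳ _) (ℕ.+-identityʳ x))

-- The first loop forms `x + y` in register 0 and saves `y` in register 2. A round of the second
-- loop that leaves the counter at `n` adds `1 + n` to register 2, restoring the counter from
-- register 3; over all rounds this adds the triangular number.
pairCmd : Cmd
pairCmd = loop 1 (inc 2 ⨾ inc 0) ⨾ loop 0 (inc 2 ⨾ loop 0 (inc 2 ⨾ inc 3) ⨾ moveInto 3 0) ⨾ moveInto 2 0

pairs : ∀ {χ o} x y σ → χ ⊢ x ∷ y ∷ 0 ∷ 0 ∷ σ , o ⟨ pairCmd ⟩ (pair x y ∷ 0 ∷ 0 ∷ 0 ∷ σ , o)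
pairs {χ} {o} x y σ =
  (for (λ { n (t , a) → a ∷ n ∷ t ∷ 0 ∷ σ }) (λ _ → o) (λ { (t , a) → suc t , suc a }) (there here)
      (λ _ _ → inc (there (there here)) ⨾ inc here) y (0 , x)
    becomes cong (λ { (t , a) → a ∷ 0 ∷ t ∷ 0 ∷ σ }) (both y 0 x))
  ⨾ triangles (y + x) (y + 0)
  ⨾ moves (λ n a → a ∷ 0 ∷ n ∷ 0 ∷ σ) (there (there here)) here _ 0
  becomes cong (λ a → a ∷ 0 ∷ 0 ∷ 0 ∷ σ)
    (trans (ℕ.+-identityʳ _) (cong₂ _+_ (cong triangle (ℕ.+-comm y x)) (ℕ.+-identityʳ y)))
  where
  both : ∀ n t a → iterate (λ { (t , a) → suc t , suc a }) (t , a) n ≡ (n + t , n + a)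
  both zero    t a = refl
  both (suc n) t a = trans (both n (suc t) (suc a)) (cong₂ _,_ (ℕ.+-suc n t) (ℕ.+-suc n a))
  triangles : ∀ n t → χ ⊢ n ∷ 0 ∷ t ∷ 0 ∷ σ , o ⟨ loop 0 (inc 2 ⨾ loop 0 (inc 2 ⨾ inc 3) ⨾ moveInto 3 0) ⟩
                        (0 ∷ 0 ∷ triangle n + t ∷ 0 ∷ σ , o)
  triangles zero    t = exit here
  triangles (suc n) t =
    again here
      (inc (there (there here))
       ⨾ (for (λ { n (t , a) → n ∷ 0 ∷ t ∷ a ∷ σ }) (λ _ → o) (λ { (t , a) → suc t , suc a }) here
            (λ _ _ → inc (there (there here)) ⨾ inc (there (there (there here)))) n (suc t , 0)
          becomes cong (λ { (t , a) → 0 ∷ 0 ∷ t ∷ a ∷ σ }) (both n (suc t) 0))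
       ⨾ (moves (λ n a → a ∷ 0 ∷ _ ∷ n ∷ σ) (there (there (there here))) here (n + 0) 0
          becomes cong₂ (λ a t → a ∷ 0 ∷ t ∷ 0 ∷ σ) (trans (ℕ.+-identityʳ _) (ℕ.+-identityʳ n)) (ℕ.+-suc n t)))
      (triangles n (suc (n + t)))
    becomes cong (λ t → 0 ∷ 0 ∷ t ∷ 0 ∷ σ)
      (trans (ℕ.+-suc (triangle n) (n + t))
        (cong suc (trans (sym (ℕ.+-assoc (triangle n) n t)) (cong (_+ t) (ℕ.+-comm (triangle n) n)))))

-- A case distinction made of loops that run at most once. Register 2 is a flag for `x = 0`. If `x`
-- is positive, the first loop clears the flag and hides the decremented `x` in register 3, which
-- ends the loop; the second loop runs if the flag is still set.
nextCmd : Cmd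
nextCmd =
  inc 2 ⨾ loop 0 (loop 2 skip ⨾ moveInto 0 3 ⨾ inc 1) ⨾ loop 2 (inc 0 ⨾ moveInto 1 0) ⨾ moveInto 3 0

store : ℕ → ℕ × ℕ → List ℕ → List ℕ
store n (x , y) σ = x ∷ y ∷ 0 ∷ 0 ∷ n ∷ σ

nexts : ∀ {χ o} n p σ → χ ⊢ store n p σ , o ⟨ nextCmd ⟩ (store n (next p) σ , o)
nexts n (zero , y) σ =
  inc (there (there here))
  ⨾ exit here
  ⨾ again (there (there here))
      (inc here ⨾ moves (λ y x → x ∷ y ∷ 0 ∷ 0 ∷ n ∷ σ) (there here) here y 1) (exit (there (there here)))
  ⨾ exit (there (there (there here)))
  becomes cong (λ x → x ∷ 0 ∷ 0 ∷ 0 ∷ n ∷ σ) (ℕ.+-comm y 1)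
nexts n (suc x , y) σ =
  inc (there (there here))
  ⨾ again here
      (clear (λ z → x ∷ y ∷ z ∷ 0 ∷ n ∷ σ) (there (there here)) 1
       ⨾ moves (λ x b → x ∷ y ∷ 0 ∷ b ∷ n ∷ σ) here (there (there (there here))) x 0
       ⨾ inc (there here))
      (exit here)
  ⨾ exit (there (there here))
  ⨾ moves (λ b x → x ∷ suc y ∷ 0 ∷ b ∷ n ∷ σ) (there (there (there here))) here (x + 0) 0
  becomes cong (λ x → x ∷ suc y ∷ 0 ∷ 0 ∷ n ∷ σ) (trans (ℕ.+-identityʳ _) (ℕ.+-identityʳ x))

unpairCmd : Cmd
unpairCmd = moveInto 0 4 ⨾ loop 4 nextCmd

unpairs : ∀ {χ o} n σ → χ ⊢ n ∷ 0 ∷ 0 ∷ 0 ∷ 0 ∷ σ , o ⟨ unpairCmd ⟩ (store 0 (unpair n) σ , o)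
unpairs {o = o} n σ =
  moves (λ n k → n ∷ 0 ∷ 0 ∷ 0 ∷ k ∷ σ) here (there (there (there (there here)))) n 0
  ⨾ for (λ n p → store n p σ) (λ _ → o) next (there (there (there (there here)))) (λ n p → nexts n p σ) (n + 0) (0 , 0)
  becomes cong (λ p → store 0 p σ) (trans (cong (iterate next (0 , 0)) (ℕ.+-identityʳ n)) (iterates n))
  where
  iterates : ∀ n → iterate next (0 , 0) n ≡ unpair n
  iterates zero    = refl
  iterates (suc n) = trans (iterate-commute next (0 , 0) n) (cong next (iterates n))

-- The argument is replaced by the value in register 0; the registers above
-- are scratch space, zero before and after.
toCmd : PR → Cmd
toCmd `id          = skip
toCmd `zero        = loop 0 skip
toCmd `suc         = inc 0
toCmd `fst         = unpairCmd ⨾ loop 1 skip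
toCmd `snd         = unpairCmd ⨾ loop 0 skip ⨾ moveInto 1 0
toCmd `query       = loop 0 (inc 1 ⨾ moveOracle right) ⨾ ask 0 ⨾ loop 1 (moveOracle left)
toCmd ⟨ f , g ⟩    = copyCmd ⨾ shiftCmd (toCmd f) ⨾ swapCmd ⨾ shiftCmd (toCmd g) ⨾ pairCmd
toCmd (f ∙ g)      = toCmd g ⨾ toCmd f
toCmd (`iterate f) = unpairCmd ⨾ loop 0 (shiftCmd (toCmd f)) ⨾ moveInto 1 0

scratch : PR → ℕ
scratch ⟨ f , g ⟩    = 4 + (scratch f + scratch g)
scratch (f ∙ g)      = scratch f + scratch g
scratch (`iterate f) = 4 + scratch f
scratch _            = 4

zeros : ℕ → List ℕ
zeros m = replicate m 0

-- Clean scratch registers and an oracle head back on cell 0 are part of the claim, which makes it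
-- compose. The bound leaves `m` free because subterms run inside the larger scratch space of their
-- context.
toCmd-correct : ∀ f {χ m} → scratch f ≤ m → ∀ n →
                χ ⊢ n ∷ zeros m , 0 ⟨ toCmd f ⟩ (⟦ f ⟧ χ n ∷ zeros m , 0)
toCmd-correct `id   _ n = skip
toCmd-correct `zero {m = m} _ n = clear (λ n → n ∷ zeros m) here n
toCmd-correct `suc  _ n = inc here
toCmd-correct `fst  (s≤s (s≤s (s≤s (s≤s {n = m} _)))) n =
  unpairs n (zeros m) ⨾ clear (λ y → _ ∷ y ∷ 0 ∷ 0 ∷ 0 ∷ zeros m) (there here) _
toCmd-correct `snd  (s≤s (s≤s (s≤s (s≤s {n = m} _)))) n =
  unpairs n (zeros m)
  ⨾ clear (λ x → x ∷ _ ∷ 0 ∷ 0 ∷ 0 ∷ zeros m) here _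
  ⨾ moves (λ y x → x ∷ y ∷ 0 ∷ 0 ∷ 0 ∷ zeros m) (there here) here _ 0
  becomes cong (λ x → x ∷ 0 ∷ 0 ∷ 0 ∷ 0 ∷ zeros m) (ℕ.+-identityʳ _)
toCmd-correct `query {χ} {suc m} _ n = queries
  where
  count : ∀ {χ} → χ ⊢ n ∷ 0 ∷ zeros m , 0 ⟨ loop 0 (inc 1 ⨾ moveOracle right) ⟩ (0 ∷ n ∷ zeros m , n)
  count {χ} = subst (λ k → χ ⊢ n ∷ 0 ∷ zeros m , 0 ⟨ loop 0 (inc 1 ⨾ moveOracle right) ⟩ (0 ∷ k ∷ zeros m , k))
    (trans (iterate-suc 0 n) (ℕ.+-identityʳ n))
    (for (λ n k → n ∷ k ∷ zeros m) (λ k → k) suc here (λ _ _ → inc (there here) ⨾ moveOracle) n 0)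
  answer : χ ⊢ 0 ∷ n ∷ zeros m , n ⟨ ask 0 ⟩ (bit (χ n) ∷ n ∷ zeros m , n)
  answer with χ n in e
  ... | true  = askYes e here
  ... | false = askNo e
  goBack : ∀ x k → χ ⊢ x ∷ k ∷ zeros m , k ⟨ loop 1 (moveOracle left) ⟩ (x ∷ 0 ∷ zeros m , 0)
  goBack x zero    = exit (there here)
  goBack x (suc k) = again (there here) moveOracle (goBack x k)
  queries : χ ⊢ n ∷ 0 ∷ zeros m , 0 ⟨ toCmd `query ⟩ (bit (χ n) ∷ 0 ∷ zeros m , 0)
  queries = count ⨾ answer ⨾ goBack (bit (χ n)) n
toCmd-correct ⟨ f , g ⟩ {χ} (s≤s (s≤s (s≤s (s≤s {n = m} f+g≤m)))) n =
  copies n (zeros (2 + m))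
  ⨾ shifted (toCmd-correct f (ℕ.≤-trans (ℕ.m≤m+n (scratch f) (scratch g)) (ℕ.m≤n⇒m≤o+n 3 f+g≤m)) n)
  ⨾ swaps n (⟦ f ⟧ χ n) (zeros (2 + m))
  ⨾ shifted (toCmd-correct g (ℕ.≤-trans (ℕ.m≤n+m (scratch g) (scratch f)) (ℕ.m≤n⇒m≤o+n 3 f+g≤m)) n)
  ⨾ pairs (⟦ f ⟧ χ n) (⟦ g ⟧ χ n) (zeros (1 + m))
toCmd-correct (f ∙ g) {χ} f+g≤m n =
  toCmd-correct g (ℕ.m+n≤o⇒n≤o (scratch f) f+g≤m) n ⨾ toCmd-correct f (ℕ.m+n≤o⇒m≤o (scratch f) f+g≤m) (⟦ g ⟧ χ n)
toCmd-correct (`iterate f) {χ} (s≤s (s≤s (s≤s (s≤s {n = m} f≤m)))) n =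
  unpairs n (zeros m)
  ⨾ for (λ k x → k ∷ x ∷ zeros (3 + m)) (λ _ → 0) (⟦ f ⟧ χ) here
      (λ _ x → shifted (toCmd-correct f (ℕ.m≤n⇒m≤o+n 3 f≤m) x)) _ _
  ⨾ moves (λ x a → a ∷ x ∷ zeros (3 + m)) (there here) here _ 0
  becomes cong (λ x → x ∷ zeros (4 + m)) (ℕ.+-identityʳ _)

-- Unbounded search

checkCmd : PR → Cmd
checkCmd t = shiftCmd copyCmd ⨾ shiftCmd (shiftCmd (toCmd t)) ⨾ moveInto 2 0

-- Register 1 holds the candidate, register 0 the outcome of the test on it. Entering the loop
-- subtracts 1 from register 0, and `checkCmd` expects to find 0 there; hence the requirement that
-- the test has values at most 1.
searchCmd : (start continue step result : PR) → Cmd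
searchCmd s t f u =
  toCmd s ⨾ moveInto 0 1 ⨾ checkCmd t ⨾ loop 0 (shiftCmd (toCmd f) ⨾ checkCmd t) ⨾ moveInto 1 0 ⨾ toCmd u

checks : ∀ t {χ m} → scratch t ≤ m → ∀ z →
         χ ⊢ 0 ∷ z ∷ zeros (2 + m) , 0 ⟨ checkCmd t ⟩ (⟦ t ⟧ χ z ∷ z ∷ zeros (2 + m) , 0)
checks t {χ} {m} t≤m z =
  shifted (copies z (zeros m))
  ⨾ shifted (shifted (toCmd-correct t (ℕ.m≤n⇒m≤1+n t≤m) z))
  ⨾ moves (λ n a → a ∷ z ∷ n ∷ zeros (1 + m)) (there (there here)) here _ 0
  becomes cong (_∷ z ∷ zeros (2 + m)) (ℕ.+-identityʳ _)

-- The recursion is on `k`, a witness that the search ends; the `j` returned is the first success,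
-- possibly earlier.
searches : ∀ t f {χ m} → scratch t ≤ m → scratch f ≤ m → (∀ z → ⟦ t ⟧ χ z ≤ 1) →
           ∀ k z → ⟦ t ⟧ χ (iterate (⟦ f ⟧ χ) z k) ≡ 0 →
           ∃[ j ] ⟦ t ⟧ χ (iterate (⟦ f ⟧ χ) z j) ≡ 0 ×
             χ ⊢ ⟦ t ⟧ χ z ∷ z ∷ zeros (2 + m) , 0 ⟨ loop 0 (shiftCmd (toCmd f) ⨾ checkCmd t) ⟩
                 (0 ∷ iterate (⟦ f ⟧ χ) z j ∷ zeros (2 + m) , 0)
searches t f {χ} t≤m f≤m t≤1 k z stop with ⟦ t ⟧ χ z in e | t≤1 z
searches t f t≤m f≤m t≤1 k z stop | zero | _ = 0 , e , exit here
searches t f t≤m f≤m t≤1 k z stop | suc (suc _) | s≤s ()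
searches t f t≤m f≤m t≤1 zero    z stop | suc zero | _ with () ← trans (sym e) stop
searches t f {χ} t≤m f≤m t≤1 (suc k) z stop | suc zero | _
  with j , stop′ , E ← searches t f t≤m f≤m t≤1 k (⟦ f ⟧ χ z) stop
  = suc j , stop′ , again here (shifted (toCmd-correct f (ℕ.m≤n⇒m≤o+n 2 f≤m) z) ⨾ checks t t≤m (⟦ f ⟧ χ z)) E

searchProgram : (start continue step result : PR) → Program
searchProgram s t f u = machine (3 + (scratch s + scratch t + scratch f + scratch u)) (searchCmd s t f u)

search-outputs : ∀ s t f u {χ} n → (∀ z → ⟦ t ⟧ χ z ≤ 1) →
                 ∀ k → ⟦ t ⟧ χ (iterate (⟦ f ⟧ χ) (⟦ s ⟧ χ (suc n)) k) ≡ 0 →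
                 ∃[ j ] ⟦ t ⟧ χ (iterate (⟦ f ⟧ χ) (⟦ s ⟧ χ (suc n)) j) ≡ 0 ×
                   Outputs χ (searchProgram s t f u) n (⟦ u ⟧ χ (iterate (⟦ f ⟧ χ) (⟦ s ⟧ χ (suc n)) j))
search-outputs s t f u {χ} n t≤1 k stop
  with j , stop′ , E ← searches t f {m = scratch s + scratch t + scratch f + scratch u}
                         (ℕ.m≤n⇒m≤n+o _ (ℕ.m≤n⇒m≤n+o _ (ℕ.m≤n+m _ (scratch s))))
                         (ℕ.m≤n⇒m≤n+o _ (ℕ.m≤n+m _ (scratch s + scratch t))) t≤1 k (⟦ s ⟧ χ (suc n)) stop
  = j , stop′ , machine-outputs {c = searchCmd s t f u}
      (toCmd-correct s (ℕ.m≤n⇒m≤o+n 3 (ℕ.m≤n⇒m≤n+o _ (ℕ.m≤n⇒m≤n+o _ (ℕ.m≤m+n _ _)))) (suc n)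
       ⨾ (moves (λ z a → z ∷ a ∷ zeros (2 + m)) here (there here) _ 0
          becomes cong (λ z → 0 ∷ z ∷ zeros (2 + m)) (ℕ.+-identityʳ _))
       ⨾ checks t (ℕ.m≤n⇒m≤n+o _ (ℕ.m≤n⇒m≤n+o _ (ℕ.m≤n+m _ (scratch s)))) _
       ⨾ E
       ⨾ (moves (λ z a → a ∷ z ∷ zeros (2 + m)) (there here) here _ 0
          becomes cong (λ z → z ∷ zeros (3 + m)) (ℕ.+-identityʳ _))
       ⨾ toCmd-correct u (ℕ.m≤n⇒m≤o+n 3 (ℕ.m≤n+m _ (scratch s + scratch t + scratch f))) _)
  where
  m : ℕ
  m = scratch s + scratch t + scratch f + scratch u

-- Functions on coded data realized by primitive recursive programs

record Coded (A : Set) : Set where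
  field code : A → ℕ

open Coded ⦃ ... ⦄

-- With this choice `List A` and `Maybe (A × List A)` have the same codes, so a case distinction on
-- lists is one on `Maybe`.
codeMaybe : {A : Set} → (A → ℕ) → Maybe A → ℕ
codeMaybe c = maybe′ (suc ∘ c) 0

instance
  codedℕ : Coded ℕ
  codedℕ = record { code = id }

  codedBool : Coded Bool
  codedBool = record { code = bit }

  coded× : {A B : Set} → ⦃ Coded A ⦄ → ⦃ Coded B ⦄ → Coded (A × B)
  coded× = record { code = λ (a , b) → pair (code a) (code b) }

  codedMaybe : {A : Set} → ⦃ Coded A ⦄ → Coded (Maybe A)
  codedMaybe = record { code = codeMaybe code }

  codedList : {A : Set} → ⦃ Coded A ⦄ → Coded (List A)
  codedList = record { code = λ as → codeList (map code as) }

  codedMove : Coded Move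
  codedMove = record { code = codeMove }

  codedInstruction : Coded Instruction
  codedInstruction = record { code = codeInstruction }

  codedTape : Coded Tape
  codedTape = record { code = λ (tape ls s rs) → code (ls , s , rs) }

  codedConfiguration : Coded Configuration
  codedConfiguration = record { code = λ (config q T o) → code (q , T , o) }

ifSuc : {B : Set} → ℕ → B → (ℕ → B) → B
ifSuc zero    z s = z
ifSuc (suc n) z s = s n

ifCons : {A B : Set} → List A → B → (A → List A → B) → B
ifCons []       z s = z
ifCons (a ∷ as) z s = s a as

ifMove : {B : Set} → Move → B → B → B → B
ifMove left  x y z = x
ifMove stay  x y z = y
ifMove right x y z = z

-- Iterates `(a , b) ↦ (b , b + 1)` from `(0 , 0)`: the first component lags one round behind, and
-- the predecessor of 0 comes out as 0.
`pred : PR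
`pred = `fst ∙ `iterate ⟨ `snd , `suc ∙ `snd ⟩ ∙ ⟨ `id , ⟨ `zero , `zero ⟩ ⟩

`numeral : ℕ → PR
`numeral zero    = `zero
`numeral (suc n) = `suc ∙ `numeral n

-- Iterating p ↦ (second p , second p) selects the second component as soon
-- as there is at least one iteration.
`case : (n z s : PR) → PR
`case n z s = `fst ∙ `iterate ⟨ `snd , `snd ⟩ ∙ ⟨ n , ⟨ z , s ∙ ⟨ `id , `pred ∙ n ⟩ ⟩ ⟩

fst-pair : ∀ x y → proj₁ (unpair (pair x y)) ≡ x
fst-pair x y = cong proj₁ (unpair-pair x y)

snd-pair : ∀ x y → proj₂ (unpair (pair x y)) ≡ y
snd-pair x y = cong proj₂ (unpair-pair x y)

module Realizability (χ : Oracle) where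

  iterate-pair : ∀ f k x → ⟦ `iterate f ⟧ χ (pair k x) ≡ iterate (⟦ f ⟧ χ) x k
  iterate-pair f k x rewrite unpair-pair k x = refl

  pred-correct : ∀ n → ⟦ `pred ⟧ χ n ≡ pred n
  pred-correct n rewrite iterate-pair ⟨ `snd , `suc ∙ `snd ⟩ n (pair 0 0) =
    trans (cong (proj₁ ∘ unpair) (counts n 0 0)) (trans (fst-pair _ _) (up n))
    where
    up : ∀ n → proj₁ (iterate (λ p → proj₂ p , suc (proj₂ p)) (0 , 0) n) ≡ pred n
    up zero    = refl
    up (suc n) = trans (go 0 n) (ℕ.+-identityʳ n)
      where
      go : ∀ k n → proj₁ (iterate (λ p → proj₂ p , suc (proj₂ p)) (k , suc k) n) ≡ n + k
      go k zero    = refl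
      go k (suc n) = trans (go (suc k) n) (ℕ.+-suc n k)
    counts : ∀ n x y → iterate (⟦ ⟨ `snd , `suc ∙ `snd ⟩ ⟧ χ) (pair x y) n ≡
                       uncurry pair (iterate (λ p → proj₂ p , suc (proj₂ p)) (x , y) n)
    counts zero    x y = refl
    counts (suc n) x y rewrite unpair-pair x y = counts n y (suc y)

  select : ∀ n x y → proj₁ (unpair (⟦ `iterate ⟨ `snd , `snd ⟩ ⟧ χ (pair n (pair x y)))) ≡ ifSuc n x (λ _ → y)
  select n x y = trans (cong (proj₁ ∘ unpair) (iterate-pair ⟨ `snd , `snd ⟩ n (pair x y))) (go n x y)
    where
    go : ∀ n x y → proj₁ (unpair (iterate (⟦ ⟨ `snd , `snd ⟩ ⟧ χ) (pair x y) n)) ≡ ifSuc n x (λ _ → y)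
    go zero    x y = fst-pair x y
    go (suc n) x y rewrite unpair-pair x y = trans (go n y y) (same n)
      where
      same : ∀ n → ifSuc n y (λ _ → y) ≡ y
      same zero    = refl
      same (suc _) = refl

  case-correct : ∀ n z s x → ⟦ `case n z s ⟧ χ x ≡ ifSuc (⟦ n ⟧ χ x) (⟦ z ⟧ χ x) (λ k → ⟦ s ⟧ χ (pair x k))
  case-correct n z s x = trans (select (⟦ n ⟧ χ x) _ _) (lemma (⟦ n ⟧ χ x) refl)
    where
    lemma : ∀ m → ⟦ n ⟧ χ x ≡ m →
            ifSuc m (⟦ z ⟧ χ x) (λ _ → ⟦ s ⟧ χ (pair x (⟦ `pred ⟧ χ (⟦ n ⟧ χ x)))) ≡
            ifSuc m (⟦ z ⟧ χ x) (λ k → ⟦ s ⟧ χ (pair x k))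
    lemma zero    _ = refl
    lemma (suc m) e = cong (⟦ s ⟧ χ ∘ pair x) (trans (pred-correct (⟦ n ⟧ χ x)) (cong pred e))

  infix 3 _realizes_
  record Rec {A B : Set} ⦃ _ : Coded A ⦄ ⦃ _ : Coded B ⦄ (f : A → B) : Set where
    constructor _realizes_
    field
      program : PR
      correct : ∀ a → ⟦ program ⟧ χ (code a) ≡ code (f a)

  module _ {A : Set} ⦃ _ : Coded A ⦄ where

    -- Covers changes of representation: constructors, projections to fields and decoders that leave
    -- the code as it is.
    ident : {B : Set} ⦃ _ : Coded B ⦄ (f : A → B) → (∀ a → code a ≡ code (f a)) → Rec f
    ident f e = `id realizes e

    retype : {B B′ : Set} ⦃ _ : Coded B ⦄ ⦃ _ : Coded B′ ⦄ {f : A → B} {g : A → B′} →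
             (∀ a → code (f a) ≡ code (g a)) → Rec f → Rec g
    retype e (c realizes p) = c realizes λ a → trans (p a) (e a)

    ext : {B : Set} ⦃ _ : Coded B ⦄ {f g : A → B} → (∀ a → f a ≡ g a) → Rec f → Rec g
    ext e = retype (cong code ∘ e)

    identity : Rec (id {A = A})
    identity = `id realizes λ _ → refl

    constant : {B : Set} ⦃ _ : Coded B ⦄ (b : B) → Rec (λ (_ : A) → b)
    constant b = `numeral (code b) realizes λ a → numeral (code b) (code a)
      where
      numeral : ∀ n x → ⟦ `numeral n ⟧ χ x ≡ n
      numeral zero    x = refl
      numeral (suc n) x = cong suc (numeral n x)

    infixr 9 _∘ᴿ_
    _∘ᴿ_ : {B C : Set} ⦃ _ : Coded B ⦄ ⦃ _ : Coded C ⦄ {g : B → C} {f : A → B} → Rec g → Rec f → Rec (λ a → g (f a))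
    _∘ᴿ_ {f = f} (d realizes q) (c realizes p) = d ∙ c realizes λ a → trans (cong (⟦ d ⟧ χ) (p a)) (q (f a))

    infixr 4 _&_
    _&_ : {B C : Set} ⦃ _ : Coded B ⦄ ⦃ _ : Coded C ⦄ {f : A → B} {g : A → C} → Rec f → Rec g → Rec (λ a → f a , g a)
    (c realizes p) & (d realizes q) = ⟨ c , d ⟩ realizes λ a → cong₂ pair (p a) (q a)

    fstᴿ : {B : Set} ⦃ _ : Coded B ⦄ → Rec (λ (p : A × B) → proj₁ p)
    fstᴿ = `fst realizes λ (a , b) → fst-pair (code a) (code b)

    sndᴿ : {B : Set} ⦃ _ : Coded B ⦄ → Rec (λ (p : A × B) → proj₂ p)
    sndᴿ = `snd realizes λ (a , b) → snd-pair (code a) (code b)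

  sucᴿ : Rec suc
  sucᴿ = `suc realizes λ _ → refl

  queryᴿ : Rec χ
  queryᴿ = `query realizes λ _ → refl

  unpairᴿ : Rec unpair
  unpairᴿ = ident unpair (λ n → sym (pair-unpair n))

  justᴿ : {A : Set} ⦃ _ : Coded A ⦄ → Rec (λ (a : A) → just a)
  justᴿ = `suc realizes λ _ → refl

  consᴿ : {A : Set} ⦃ _ : Coded A ⦄ → Rec (λ (p : A × List A) → proj₁ p ∷ proj₂ p)
  consᴿ = `suc realizes λ _ → refl

  module _ {Γ : Set} ⦃ _ : Coded Γ ⦄ {B : Set} ⦃ _ : Coded B ⦄ where

    ifSucᴿ : {n : Γ → ℕ} {z : Γ → B} {s : Γ × ℕ → B} → Rec n → Rec z → Rec s →
             Rec (λ γ → ifSuc (n γ) (z γ) (λ k → s (γ , k)))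
    ifSucᴿ {n} {z} {s} (cn realizes pn) (cz realizes pz) (cs realizes ps) = `case cn cz cs realizes λ γ →
      trans (case-correct cn cz cs (code γ)) (trans (cong (λ m → ifSuc m _ _) (pn γ)) (cases γ (n γ)))
      where
      cases : ∀ γ m → ifSuc m (⟦ cz ⟧ χ (code γ)) (λ k → ⟦ cs ⟧ χ (pair (code γ) k)) ≡
                      code (ifSuc m (z γ) (λ k → s (γ , k)))
      cases γ zero    = pz γ
      cases γ (suc k) = ps (γ , k)

    ifᴿ : {b : Γ → Bool} {t e : Γ → B} → Rec b → Rec t → Rec e → Rec (λ γ → if b γ then t γ else e γ)
    ifᴿ {b} {t} {e} rb rt re =
      ext (λ γ → cases γ (b γ)) (ifSucᴿ {s = t ∘ proj₁} (retype (λ _ → refl) rb) re (rt ∘ᴿ fstᴿ))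
      where
      cases : ∀ γ b → ifSuc (bit b) (e γ) (λ _ → t γ) ≡ (if b then t γ else e γ)
      cases γ true  = refl
      cases γ false = refl

    maybeᴿ : {A : Set} ⦃ _ : Coded A ⦄ {m : Γ → Maybe A} {z : Γ → B} {s : Γ × A → B} → Rec m → Rec z → Rec s →
             Rec (λ γ → maybe′ (λ a → s (γ , a)) (z γ) (m γ))
    maybeᴿ {m = m} {z} {s} (cm realizes pm) (cz realizes pz) (cs realizes ps) = `case cm cz cs realizes λ γ →
      trans (case-correct cm cz cs (code γ)) (trans (cong (λ m → ifSuc m _ _) (pm γ)) (cases γ (m γ)))
      where
      cases : ∀ γ m → ifSuc (code m) (⟦ cz ⟧ χ (code γ)) (λ k → ⟦ cs ⟧ χ (pair (code γ) k)) ≡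
                      code (maybe′ (λ a → s (γ , a)) (z γ) m)
      cases γ nothing  = pz γ
      cases γ (just a) = ps (γ , a)

    ifConsᴿ : {A : Set} ⦃ _ : Coded A ⦄ {l : Γ → List A} {z : Γ → B} {s : Γ × (A × List A) → B} →
              Rec l → Rec z → Rec s →
              Rec (λ γ → ifCons (l γ) (z γ) (λ a as → s (γ , a , as)))
    ifConsᴿ {A} {l} {z} {s} (cl realizes pl) rz rs =
      ext (λ γ → cases γ (l γ)) (maybeᴿ {m = uncons ∘ l} (cl realizes λ γ → trans (pl γ) (uncons-code (l γ))) rz rs)
      where
      uncons : List A → Maybe (A × List A)
      uncons []       = nothing
      uncons (a ∷ as) = just (a , as)
      uncons-code : ∀ l → code l ≡ code (uncons l)
      uncons-code []      = refl
      uncons-code (_ ∷ _) = refl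
      cases : ∀ γ l → maybe′ (λ p → s (γ , p)) (z γ) (uncons l) ≡ ifCons l (z γ) (λ a as → s (γ , a , as))
      cases γ []      = refl
      cases γ (_ ∷ _) = refl

    -- The context rides along as first component of the iterated pair, since the iterated program
    -- sees nothing else.
    iterateᴿ : {f : Γ × B → B} {x : Γ → B} {n : Γ → ℕ} → Rec f → Rec x → Rec n →
               Rec (λ γ → iterate (λ b → f (γ , b)) (x γ) (n γ))
    iterateᴿ {f} {x} {n} (cf realizes pf) (cx realizes px) (cn realizes pn) =
      `snd ∙ `iterate ⟨ `fst , cf ⟩ ∙ ⟨ cn , ⟨ `id , cx ⟩ ⟩ realizes λ γ →
      trans (cong (proj₂ ∘ unpair)
              (trans (iterate-pair ⟨ `fst , cf ⟩ (⟦ cn ⟧ χ (code γ)) (pair (code γ) (⟦ cx ⟧ χ (code γ))))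
                (trans (cong₂ (λ b k → iterate (⟦ ⟨ `fst , cf ⟩ ⟧ χ) (pair (code γ) b) k) (px γ) (pn γ)) (go γ (x γ) (n γ)))))
            (snd-pair (code γ) _)
      where
      go : ∀ γ b k → iterate (⟦ ⟨ `fst , cf ⟩ ⟧ χ) (pair (code γ) (code b)) k ≡
                     pair (code γ) (code (iterate (λ b → f (γ , b)) b k))
      go γ b zero    = refl
      go γ b (suc k) =
        trans (cong (λ p → iterate (⟦ ⟨ `fst , cf ⟩ ⟧ χ) p k) (cong₂ pair (fst-pair (code γ) (code b)) (pf (γ , b))))
          (go γ (f (γ , b)) k)

  ifMoveᴿ : {Γ B : Set} ⦃ _ : Coded Γ ⦄ ⦃ _ : Coded B ⦄ {m : Γ → Move} {l s r : Γ → B} →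
            Rec m → Rec l → Rec s → Rec r → Rec (λ γ → ifMove (m γ) (l γ) (s γ) (r γ))
  ifMoveᴿ {m = m} {l} {s} {r} rm rl rs rr =
    ext (λ γ → cases γ (m γ))
      (ifSucᴿ {s = λ (γ , k) → ifSuc k (s γ) (λ _ → r γ)} (retype {g = codeMove ∘ m} (λ _ → refl) rm) rl
        (ifSucᴿ {s = r ∘ proj₁ ∘ proj₁} sndᴿ (rs ∘ᴿ fstᴿ) (rr ∘ᴿ fstᴿ ∘ᴿ fstᴿ)))
    where
    cases : ∀ γ m → ifSuc (codeMove m) (l γ) (λ k → ifSuc k (s γ) (λ _ → r γ)) ≡ ifMove m (l γ) (s γ) (r γ)
    cases γ left  = refl
    cases γ stay  = refl
    cases γ right = refl

  module _ {Γ A B : Set} ⦃ _ : Coded Γ ⦄ ⦃ _ : Coded A ⦄ ⦃ _ : Coded B ⦄ where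

    -- The number of rounds is the code of the list, a bound on its length that is at hand; rounds
    -- after the list is exhausted change nothing.
    foldlᴿ : {f : Γ × (B × A) → B} {x : Γ → B} {l : Γ → List A} → Rec f → Rec x → Rec l →
             Rec (λ γ → foldl (λ b a → f (γ , b , a)) (x γ) (l γ))
    foldlᴿ {f} {x} {l} rf rx rl =
      ext (λ γ → consume γ (x γ) (l γ) (code (l γ)) (length≤code (l γ)))
        (fstᴿ ∘ᴿ iterateᴿ {f = λ (γ , p) → stepFn γ p}
          (ifConsᴿ {l = proj₂ ∘ proj₂} {s = λ ((γ , b , l) , a , as) → f (γ , b , a) , as} (sndᴿ ∘ᴿ sndᴿ) sndᴿ
            ((rf ∘ᴿ (fstᴿ ∘ᴿ fstᴿ & fstᴿ ∘ᴿ sndᴿ ∘ᴿ fstᴿ & fstᴿ ∘ᴿ sndᴿ)) & sndᴿ ∘ᴿ sndᴿ))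
          (rx & rl) (retype {g = code ∘ l} (λ _ → refl) rl))
      where
      stepFn : Γ → B × List A → B × List A
      stepFn γ (b , l) = ifCons l (b , l) (λ a as → f (γ , b , a) , as)
      length≤code : (l : List A) → length l ≤ code l
      length≤code []       = z≤n
      length≤code (a ∷ as) = s≤s (ℕ.≤-trans (length≤code as) (ℕ.m≤n+m _ _))
      consume : ∀ γ b l k → length l ≤ k → proj₁ (iterate (stepFn γ) (b , l) k) ≡ foldl (λ b a → f (γ , b , a)) b l
      consume γ b []       zero    _ = refl
      consume γ b []       (suc k) _ = consume γ b [] k z≤n
      consume γ b (a ∷ as) (suc k) (s≤s p) = consume γ (f (γ , b , a)) as k p

-- Bounded runs and the decoding of programs

proceed : Oracle → Program → Configuration → Configuration
proceed χ P C = maybe′ id C (step χ P C)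

isHalted : Oracle → Program → Configuration → Bool
isHalted χ P C = maybe′ (λ _ → false) true (step χ P C)

runFor : Oracle → Program → ℕ → Configuration → Configuration
runFor χ P k C = iterate (proceed χ P) C k

-- The first argument is fuel. The code of a list exceeds that of its tail, so the number itself is
-- enough fuel.
decodeListUpTo : ℕ → ℕ → List ℕ
decodeListUpTo zero    _       = []
decodeListUpTo (suc k) zero    = []
decodeListUpTo (suc k) (suc n) = proj₁ (unpair n) ∷ decodeListUpTo k (proj₂ (unpair n))

decodeList : ℕ → List ℕ
decodeList n = decodeListUpTo n n

n≤pair : ∀ m n → n ≤ pair m n
n≤pair m n = ℕ.m≤n+m n _

codeList-decodeList : ∀ n → codeList (decodeList n) ≡ n
codeList-decodeList n = go n n ℕ.≤-refl
  where
  go : ∀ k n → n ≤ k → codeList (decodeListUpTo k n) ≡ n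
  go zero    zero    _       = refl
  go (suc k) zero    _       = refl
  go (suc k) (suc n) (s≤s p) =
    cong suc (trans (cong (pair (proj₁ (unpair n))) (go k (proj₂ (unpair n)) snd≤k)) (pair-unpair n))
    where
    snd≤k : proj₂ (unpair n) ≤ k
    snd≤k = ℕ.≤-trans (subst (proj₂ (unpair n) ≤_) (pair-unpair n) (n≤pair (proj₁ (unpair n)) (proj₂ (unpair n)))) p

decodeList-codeList : ∀ ns → decodeList (codeList ns) ≡ ns
decodeList-codeList ns = go (codeList ns) ns ℕ.≤-refl
  where
  go : ∀ k ns → codeList ns ≤ k → decodeListUpTo k (codeList ns) ≡ ns
  go zero    []       _       = refl
  go (suc k) []       _       = refl
  go (suc k) (n ∷ ns) (s≤s p) rewrite unpair-pair n (codeList ns) =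
    cong (n ∷_) (go k ns (ℕ.≤-trans (n≤pair n (codeList ns)) p))

decodeMove : ℕ → Move
decodeMove n = ifSuc n left (λ k → ifSuc k stay (λ _ → right))

decodeBit : ℕ → Bool
decodeBit n = ifSuc n false (λ _ → true)

fields : Instruction → List ℕ
fields (instruction q s b q′ s′ m o) = q ∷ s ∷ bit b ∷ q′ ∷ s′ ∷ codeMove m ∷ codeMove o ∷ []

-- `cell` serves as indexing with default 0, so any list decodes to some instruction. Decoding is
-- many-to-one: every positive number, for example, is read as the bit `true`.
fromFields : List ℕ → Instruction
fromFields ns =
  instruction (cell ns 0) (cell ns 1) (decodeBit (cell ns 2)) (cell ns 3) (cell ns 4)
    (decodeMove (cell ns 5)) (decodeMove (cell ns 6))

decodeProgram : ℕ → Program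
decodeProgram n = map (fromFields ∘ decodeList) (decodeList n)

decodeProgram-⌜⌝ : ∀ P → decodeProgram ⌜ P ⌝ ≡ P
decodeProgram-⌜⌝ P = trans (cong (map (fromFields ∘ decodeList)) (decodeList-codeList (map codeInstruction P))) (go P)
  where
  decodeMove-code : ∀ m → decodeMove (codeMove m) ≡ m
  decodeMove-code left  = refl
  decodeMove-code stay  = refl
  decodeMove-code right = refl
  decodeBit-bit : ∀ b → decodeBit (bit b) ≡ b
  decodeBit-bit false = refl
  decodeBit-bit true  = refl
  decode-code : ∀ I → fromFields (decodeList (codeInstruction I)) ≡ I
  decode-code I@(instruction q s b q′ s′ m o) =
    trans (cong fromFields (decodeList-codeList (fields I)))
      (trans (cong (λ b → instruction q s b q′ s′ (decodeMove (codeMove m)) (decodeMove (codeMove o))) (decodeBit-bit b))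
        (cong₂ (instruction q s b q′ s′) (decodeMove-code m) (decodeMove-code o)))
  go : ∀ P → map (fromFields ∘ decodeList) (map codeInstruction P) ≡ P
  go []      = refl
  go (I ∷ P) = cong₂ _∷_ (decode-code I) (go P)

-- Realizers for the simulation of machines

module Realizers (χ : Oracle) where
  open Realizability χ

  foldrᴿ : {Γ A B : Set} ⦃ _ : Coded Γ ⦄ ⦃ _ : Coded A ⦄ ⦃ _ : Coded B ⦄
           {f : Γ × (B × A) → B} {x : Γ → B} {l : Γ → List A} → Rec f → Rec x → Rec l →
           Rec (λ γ → foldr (λ a b → f (γ , b , a)) (x γ) (l γ))
  foldrᴿ {A = A} {f = f} {x} {l} rf rx rl =
    ext (λ γ → trans (sym (reverse-foldr (λ a b → f (γ , b , a)) (x γ) (reverse (l γ))))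
                     (cong (foldr (λ a b → f (γ , b , a)) (x γ)) (reverse-involutive (l γ))))
      (foldlᴿ rf rx (foldlᴿ {f = λ (_ , as , a) → a ∷ as} (consᴿ ∘ᴿ (sndᴿ ∘ᴿ sndᴿ & fstᴿ ∘ᴿ sndᴿ)) (constant []) rl))

  module _ {Γ : Set} ⦃ _ : Coded Γ ⦄ where

    predᴿ : {n : Γ → ℕ} → Rec n → Rec (λ γ → pred (n γ))
    predᴿ {n} rn = ext (λ γ → cases (n γ)) (ifSucᴿ {s = proj₂} rn (constant 0) sndᴿ)
      where
      cases : ∀ n → ifSuc n 0 id ≡ pred n
      cases zero    = refl
      cases (suc _) = refl

    ∧ᴿ : {b c : Γ → Bool} → Rec b → Rec c → Rec (λ γ → b γ ∧ c γ)
    ∧ᴿ {b} {c} rb rc = ext (λ γ → cases (b γ)) (ifᴿ rb rc (constant false))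
      where
      cases : ∀ b {c} → (if b then c else false) ≡ b ∧ c
      cases true  = refl
      cases false = refl

    notᴿ : {b : Γ → Bool} → Rec b → Rec (λ γ → not (b γ))
    notᴿ {b} rb = ext (λ γ → cases (b γ)) (ifᴿ rb (constant false) (constant true))
      where
      cases : ∀ b → (if b then false else true) ≡ not b
      cases true  = refl
      cases false = refl

  module _ {Γ : Set} ⦃ _ : Coded Γ ⦄ where

    ∸ᴿ : {m n : Γ → ℕ} → Rec m → Rec n → Rec (λ γ → m γ ∸ n γ)
    ∸ᴿ {m} {n} rm rn = ext (λ γ → subtracts (m γ) (n γ)) (iterateᴿ {f = pred ∘ proj₂} (predᴿ sndᴿ) rm rn)
      where
      subtracts : ∀ m n → iterate pred m n ≡ m ∸ n
      subtracts m zero    = refl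
      subtracts m (suc n) = trans (iterate-commute pred m n) (trans (cong pred (subtracts m n)) (ℕ.pred[m∸n]≡m∸[1+n] m n))

    +ᴿ : {m n : Γ → ℕ} → Rec m → Rec n → Rec (λ γ → m γ + n γ)
    +ᴿ {m} {n} rm rn = ext (λ γ → iterate-suc (n γ) (m γ)) (iterateᴿ {f = suc ∘ proj₂} (sucᴿ ∘ᴿ sndᴿ) rn rm)

    -- Two numbers are equal exactly when both truncated differences vanish.
    ≡ᵇᴿ : {m n : Γ → ℕ} → Rec m → Rec n → Rec (λ γ → m γ ≡ᵇ n γ)
    ≡ᵇᴿ {m} {n} rm rn =
      ext (λ γ → decides (m γ) (n γ))
        (ifSucᴿ {s = λ _ → false} (+ᴿ (∸ᴿ rm rn) (∸ᴿ rn rm)) (constant true) (constant false))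
      where
      decides : ∀ m n → ifSuc ((m ∸ n) + (n ∸ m)) true (λ _ → false) ≡ (m ≡ᵇ n)
      decides zero    zero    = refl
      decides zero    (suc n) = refl
      decides (suc m) zero    = refl
      decides (suc m) (suc n) = decides m n

  bitᴿ : Rec bit
  bitᴿ = ident bit (λ _ → refl)

  cellᴿ : ∀ j → Rec (λ ns → cell ns j)
  cellᴿ zero    = ext (λ { [] → refl ; (_ ∷ _) → refl })
                    (ifConsᴿ {s = λ (_ , n , _) → n} identity (constant 0) (fstᴿ ∘ᴿ sndᴿ))
  cellᴿ (suc j) = ext (λ { [] → refl ; (_ ∷ _) → refl })
                    (ifConsᴿ {s = λ (_ , _ , ns) → cell ns j} identity (constant 0) (cellᴿ j ∘ᴿ sndᴿ ∘ᴿ sndᴿ))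

  -- Instructions, tapes and configurations

  fieldᴿ : {B : Set} ⦃ _ : Coded B ⦄ {f : Instruction → B} (j : ℕ) → (∀ I → cell (fields I) j ≡ code (f I)) → Rec f
  fieldᴿ j e = retype e (cellᴿ j ∘ᴿ ident fields (λ _ → refl))

  workᴿ : Rec Configuration.work
  workᴿ = fstᴿ ∘ᴿ sndᴿ ∘ᴿ ident (λ (config q T o) → q , T , o) (λ _ → refl)

  stateᴿ : Rec Configuration.state
  stateᴿ = fstᴿ ∘ᴿ ident (λ (config q T o) → q , T , o) (λ _ → refl)

  oracleᴿ : Rec Configuration.oracle
  oracleᴿ = sndᴿ ∘ᴿ sndᴿ ∘ᴿ ident (λ (config q T o) → q , T , o) (λ _ → refl)

  beforeᴿ : Rec Tape.before
  beforeᴿ = fstᴿ ∘ᴿ ident (λ (tape ls s rs) → ls , s , rs) (λ _ → refl)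

  scannedᴿ : Rec Tape.scanned
  scannedᴿ = fstᴿ ∘ᴿ sndᴿ ∘ᴿ ident (λ (tape ls s rs) → ls , s , rs) (λ _ → refl)

  afterᴿ : Rec Tape.after
  afterᴿ = sndᴿ ∘ᴿ sndᴿ ∘ᴿ ident (λ (tape ls s rs) → ls , s , rs) (λ _ → refl)

  module _ {Γ : Set} ⦃ _ : Coded Γ ⦄ where

    tapeᴿ : {ls rs : Γ → List Symbol} {s : Γ → Symbol} → Rec ls → Rec s → Rec rs → Rec (λ γ → tape (ls γ) (s γ) (rs γ))
    tapeᴿ rl rs rr = ident (λ (ls , s , rs) → tape ls s rs) (λ _ → refl) ∘ᴿ (rl & rs & rr)

    configᴿ : {q o : Γ → ℕ} {T : Γ → Tape} → Rec q → Rec T → Rec o → Rec (λ γ → config (q γ) (T γ) (o γ))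
    configᴿ rq rT ro = ident (λ (q , T , o) → config q T o) (λ _ → refl) ∘ᴿ (rq & rT & ro)

  shift-leftᴿ : Rec (shift left)
  shift-leftᴿ =
    ext (λ { (tape [] s rs) → refl ; (tape (_ ∷ _) s rs) → refl })
      (ifConsᴿ {z = λ T → tape [] blank (Tape.scanned T ∷ Tape.after T)}
               {s = λ (T , l , ls) → tape ls l (Tape.scanned T ∷ Tape.after T)}
        beforeᴿ
        (tapeᴿ (constant []) (constant blank) (consᴿ ∘ᴿ (scannedᴿ & afterᴿ)))
        (tapeᴿ (sndᴿ ∘ᴿ sndᴿ) (fstᴿ ∘ᴿ sndᴿ) (consᴿ ∘ᴿ (scannedᴿ ∘ᴿ fstᴿ & afterᴿ ∘ᴿ fstᴿ))))

  shift-rightᴿ : Rec (shift right)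
  shift-rightᴿ =
    ext (λ { (tape ls s []) → refl ; (tape ls s (_ ∷ _)) → refl })
      (ifConsᴿ {z = λ T → tape (Tape.scanned T ∷ Tape.before T) blank []}
               {s = λ (T , r , rs) → tape (Tape.scanned T ∷ Tape.before T) r rs}
        afterᴿ
        (tapeᴿ (consᴿ ∘ᴿ (scannedᴿ & beforeᴿ)) (constant blank) (constant []))
        (tapeᴿ (consᴿ ∘ᴿ (scannedᴿ ∘ᴿ fstᴿ & beforeᴿ ∘ᴿ fstᴿ)) (fstᴿ ∘ᴿ sndᴿ) (sndᴿ ∘ᴿ sndᴿ)))

  shiftᴿ : Rec (uncurry shift)
  shiftᴿ = ext (λ { (left , T) → refl ; (stay , T) → refl ; (right , T) → refl })
             (ifMoveᴿ fstᴿ (shift-leftᴿ ∘ᴿ sndᴿ) sndᴿ (shift-rightᴿ ∘ᴿ sndᴿ))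

  shiftOracleᴿ : Rec (uncurry shiftOracle)
  shiftOracleᴿ = ext (λ { (left , o) → refl ; (stay , o) → refl ; (right , o) → refl })
                   (ifMoveᴿ fstᴿ (predᴿ sndᴿ) sndᴿ (sucᴿ ∘ᴿ sndᴿ))

  executeᴿ : Rec (uncurry execute)
  executeᴿ =
    configᴿ (fieldᴿ 3 (λ _ → refl) ∘ᴿ sndᴿ)
      (shiftᴿ ∘ᴿ (fieldᴿ {f = Instruction.move} 5 (λ _ → refl) ∘ᴿ sndᴿ
                & tapeᴿ (beforeᴿ ∘ᴿ workᴿ ∘ᴿ fstᴿ) (fieldᴿ {f = Instruction.write} 4 (λ _ → refl) ∘ᴿ sndᴿ) (afterᴿ ∘ᴿ workᴿ ∘ᴿ fstᴿ)))
      (shiftOracleᴿ ∘ᴿ (fieldᴿ {f = Instruction.oracleMove} 6 (λ _ → refl) ∘ᴿ sndᴿ & oracleᴿ ∘ᴿ fstᴿ))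

  module _ {Γ : Set} ⦃ _ : Coded Γ ⦄ where

    appliesᴿ : {q s : Γ → ℕ} {b : Γ → Bool} {I : Γ → Instruction} → Rec q → Rec s → Rec b → Rec I →
               Rec (λ γ → does (applies? (q γ) (s γ) (b γ) (I γ)))
    appliesᴿ {b = b} {I} rq rs rb rI =
      ∧ᴿ (≡ᵇᴿ (fieldᴿ 0 (λ _ → refl) ∘ᴿ rI) rq)
        (∧ᴿ (≡ᵇᴿ (fieldᴿ 1 (λ _ → refl) ∘ᴿ rI) rs)
          (ext (λ γ → decides (Instruction.answer (I γ)) (b γ))
            (≡ᵇᴿ (bitᴿ ∘ᴿ fieldᴿ {f = Instruction.answer} 2 (λ _ → refl) ∘ᴿ rI) (bitᴿ ∘ᴿ rb))))
      where
      decides : ∀ a b → (bit a ≡ᵇ bit b) ≡ does (a Bool.≟ b)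
      decides false false = refl
      decides false true  = refl
      decides true  false = refl
      decides true  true  = refl

  module _ {Γ : Set} ⦃ _ : Coded Γ ⦄ where

    -- The simulated oracle `ω` is any realized predicate and may depend on the context: it will be
    -- a stage of an enumeration whose index is data.
    stepᴿ : {ω : Γ × ℕ → Bool} {P : Γ → Program} {C : Γ → Configuration} → Rec ω → Rec P → Rec C →
            Rec (λ γ → step (λ i → ω (γ , i)) (P γ) (C γ))
    stepᴿ {ω} {P} {C} rω rP rC =
      maybeᴿ {m = λ γ → find (wanted γ) (P γ)} {s = λ (γ , I) → just (execute (C γ) I)}
        (ext (λ γ → sym (find-foldr γ (P γ)))
          (foldrᴿ {f = λ (γ , m , I) → if does (wanted γ I) then just I else m}
            (ifᴿ (appliesᴿ (stateᴿ ∘ᴿ rC ∘ᴿ fstᴿ) (scannedᴿ ∘ᴿ workᴿ ∘ᴿ rC ∘ᴿ fstᴿ)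
                   (rω ∘ᴿ (fstᴿ & oracleᴿ ∘ᴿ rC ∘ᴿ fstᴿ)) (sndᴿ ∘ᴿ sndᴿ))
              (justᴿ ∘ᴿ sndᴿ ∘ᴿ sndᴿ) (fstᴿ ∘ᴿ sndᴿ))
            (constant nothing) rP))
        (constant nothing)
        (justᴿ ∘ᴿ executeᴿ ∘ᴿ (rC ∘ᴿ fstᴿ & sndᴿ))
      where
      wanted : ∀ γ I → _
      wanted γ = applies? (Configuration.state (C γ)) (Tape.scanned (Configuration.work (C γ)))
                   (ω (γ , Configuration.oracle (C γ)))
      find-foldr : ∀ γ Is → find (wanted γ) Is ≡ foldr (λ I m → if does (wanted γ I) then just I else m) nothing Is
      find-foldr γ []       = refl
      find-foldr γ (I ∷ Is) = cong (λ m → if does (wanted γ I) then just I else m) (find-foldr γ Is)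

    isHaltedᴿ : {ω : Γ × ℕ → Bool} {P : Γ → Program} {C : Γ → Configuration} → Rec ω → Rec P → Rec C →
                Rec (λ γ → isHalted (λ i → ω (γ , i)) (P γ) (C γ))
    isHaltedᴿ rω rP rC = maybeᴿ {s = λ _ → false} (stepᴿ rω rP rC) (constant true) (constant false)

  module _ {Γ : Set} ⦃ _ : Coded Γ ⦄ where

    runForᴿ : {ω : Γ × ℕ → Bool} {P : Γ → Program} {k : Γ → ℕ} {C : Γ → Configuration} →
              Rec ω → Rec P → Rec k → Rec C → Rec (λ γ → runFor (λ i → ω (γ , i)) (P γ) (k γ) (C γ))
    runForᴿ {ω} {P} rω rP rk rC =
      iterateᴿ {f = λ (γ , C) → proceed (λ i → ω (γ , i)) (P γ) C}
        (maybeᴿ {s = proj₂}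
          (stepᴿ {ω = λ ((γ , _) , i) → ω (γ , i)} (rω ∘ᴿ (fstᴿ ∘ᴿ fstᴿ & sndᴿ)) (rP ∘ᴿ fstᴿ) sndᴿ)
          sndᴿ sndᴿ)
        rC rk

    initialᴿ : {n : Γ → ℕ} → Rec n → Rec (λ γ → initial (n γ))
    initialᴿ {n} rn =
      configᴿ (constant 0)
        (tapeᴿ (constant []) (constant stroke)
          (ext (λ γ → replicates (n γ))
            (iterateᴿ {f = λ (_ , ss) → stroke ∷ ss} (consᴿ ∘ᴿ (constant stroke & sndᴿ)) (constant []) rn)))
        (constant 0)
      where
      replicates : ∀ n → iterate (stroke ∷_) [] n ≡ replicate n stroke
      replicates zero    = refl
      replicates (suc n) = trans (iterate-commute (stroke ∷_) [] n) (cong (stroke ∷_) (replicates n))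

    outputᴿ : {C : Γ → Configuration} → Rec C → Rec (λ γ → output (C γ))
    outputᴿ {C} rC =
      ext (λ γ → counts (C γ))
        (foldrᴿ {f = λ (_ , n , s) → count s n} countᴿ
          (foldrᴿ {f = λ (_ , n , s) → count s n} countᴿ (constant 0)
            (consᴿ ∘ᴿ (scannedᴿ ∘ᴿ workᴿ ∘ᴿ rC & afterᴿ ∘ᴿ workᴿ ∘ᴿ rC)))
          (beforeᴿ ∘ᴿ workᴿ ∘ᴿ rC))
      where
      count : Symbol → ℕ → ℕ
      count s n = if s ≡ᵇ stroke then suc n else n
      countᴿ : Rec (λ ((_ , n , s) : Γ × ℕ × Symbol) → count s n)
      countᴿ = ifᴿ (≡ᵇᴿ (sndᴿ ∘ᴿ sndᴿ) (constant stroke)) (sucᴿ ∘ᴿ fstᴿ ∘ᴿ sndᴿ) (fstᴿ ∘ᴿ sndᴿ)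
      length-filter : ∀ ss → foldr count 0 ss ≡ length (filter (ℕ._≟ stroke) ss)
      length-filter []       = refl
      length-filter (s ∷ ss) with s ≡ᵇ stroke
      ... | true  = cong suc (length-filter ss)
      ... | false = length-filter ss
      counts : ∀ C → foldr count (foldr count 0 (Tape.scanned (Configuration.work C) ∷ Tape.after (Configuration.work C)))
                       (Tape.before (Configuration.work C)) ≡ output C
      counts (config q (tape ls s rs) o) = trans (sym (foldr-++ count 0 ls (s ∷ rs))) (length-filter (ls ++ s ∷ rs))

  -- `codeList` is onto, so decoding a list leaves the number itself unchanged; `decodeProgram`,
  -- which normalises its argument, has to be computed.
  decodeListᴿ : Rec decodeList
  decodeListᴿ = ident decodeList (λ n →
    trans (sym (codeList-decodeList n)) (cong codeList (sym (map-id (decodeList n)))))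

  decodeMoveᴿ : Rec decodeMove
  decodeMoveᴿ = ifSucᴿ {s = λ (_ , k) → ifSuc k stay (λ _ → right)} identity (constant left)
    (ifSucᴿ {s = λ _ → right} sndᴿ (constant stay) (constant right))

  fromFieldsᴿ : Rec fromFields
  fromFieldsᴿ = retype (λ _ → refl)
    (fieldsOfᴿ (cellᴿ 0) (fieldsOfᴿ (cellᴿ 1)
      (fieldsOfᴿ (bitᴿ ∘ᴿ ifSucᴿ {s = λ _ → true} (cellᴿ 2) (constant false) (constant true))
        (fieldsOfᴿ (cellᴿ 3) (fieldsOfᴿ (cellᴿ 4)
          (fieldsOfᴿ (codeMoveᴿ ∘ᴿ decodeMoveᴿ ∘ᴿ cellᴿ 5) (fieldsOfᴿ (codeMoveᴿ ∘ᴿ decodeMoveᴿ ∘ᴿ cellᴿ 6) (constant []))))))))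
    where
    codeMoveᴿ : Rec codeMove
    codeMoveᴿ = ident codeMove (λ _ → refl)
    fieldsOfᴿ : {f : List ℕ → ℕ} {g : List ℕ → List ℕ} → Rec f → Rec g → Rec (λ ns → f ns ∷ g ns)
    fieldsOfᴿ rf rg = consᴿ ∘ᴿ (rf & rg)

  decodeProgramᴿ : Rec decodeProgram
  decodeProgramᴿ =
    ext (λ n → map-foldr (decodeList n))
      (foldrᴿ {f = λ (_ , Is , m) → fromFields (decodeList m) ∷ Is}
        (consᴿ ∘ᴿ (fromFieldsᴿ ∘ᴿ decodeListᴿ ∘ᴿ sndᴿ ∘ᴿ sndᴿ & fstᴿ ∘ᴿ sndᴿ)) (constant []) decodeListᴿ)
    where
    map-foldr : ∀ ms → foldr (λ m Is → fromFields (decodeList m) ∷ Is) [] ms ≡ map (fromFields ∘ decodeList) ms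
    map-foldr []       = refl
    map-foldr (m ∷ ms) = cong (fromFields (decodeList m) ∷_) (map-foldr ms)

  ⌜⌝ᴿ : Rec ⌜_⌝
  ⌜⌝ᴿ = ident ⌜_⌝ (λ _ → refl)

  -- Unbounded search with a realized test

  private
    -- The start map takes a predecessor because the machine finds `suc n` in its register; the test
    -- is negated because the search stops at value 0.
    searchWith : {T : ℕ × ℕ → Bool} {U : ℕ × ℕ → ℕ} →
                 Rec {ℕ} {ℕ × ℕ} (λ n → pred n , 0) → Rec {ℕ × ℕ} (λ p → not (T p)) →
                 Rec {ℕ × ℕ} {ℕ × ℕ} (λ (n , k) → n , suc k) → Rec U →
                 ∃[ P ] ∀ n → ∃[ k ] T (n , k) ≡ true → ∃[ j ] T (n , j) ≡ true × Outputs χ P n (U (n , j))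
    searchWith {T} {U} (s realizes s-correct) (t realizes t-correct) (f realizes f-correct) (u realizes u-correct) =
      searchProgram s t f u , found
      where
      iterates : ∀ n s k → iterate (⟦ f ⟧ χ) (pair n s) k ≡ pair n (k + s)
      iterates n s zero    = refl
      iterates n s (suc k) =
        trans (cong (λ p → iterate (⟦ f ⟧ χ) p k) (f-correct (n , s)))
          (trans (iterates n (suc s) k) (cong (pair n) (ℕ.+-suc k s)))
      candidate : ∀ n k → iterate (⟦ f ⟧ χ) (⟦ s ⟧ χ (suc n)) k ≡ pair n k
      candidate n k = trans (cong (λ p → iterate (⟦ f ⟧ χ) p k) (s-correct (suc n)))
                        (trans (iterates n 0 k) (cong (pair n) (ℕ.+-identityʳ k)))
      bit≤1 : ∀ b → bit b ≤ 1
      bit≤1 true  = s≤s z≤n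
      bit≤1 false = z≤n
      -- Every number codes a pair, so the bound holds beyond the candidates actually tried.
      test≤1 : ∀ z → ⟦ t ⟧ χ z ≤ 1
      test≤1 z = subst (λ z → ⟦ t ⟧ χ z ≤ 1) (pair-unpair z)
                   (subst (_≤ 1) (sym (t-correct (unpair z))) (bit≤1 (not (T (unpair z)))))
      bit-not : ∀ b → bit (not b) ≡ 0 → b ≡ true
      bit-not true _ = refl
      found : ∀ n → ∃[ k ] T (n , k) ≡ true →
              ∃[ j ] T (n , j) ≡ true × Outputs χ (searchProgram s t f u) n (U (n , j))
      found n (k , Tk) =
        let j , stop , out = search-outputs s t f u n test≤1 k
              (trans (cong (⟦ t ⟧ χ) (candidate n k)) (trans (t-correct (n , k)) (cong (bit ∘ not) Tk)))
        in j , bit-not (T (n , j)) (trans (sym (t-correct (n , j)))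
             (trans (cong (⟦ t ⟧ χ) (sym (candidate n j))) stop)) ,
           subst (Outputs χ (searchProgram s t f u) n) (trans (cong (⟦ u ⟧ χ) (candidate n j)) (u-correct (n , j))) out

  abstract
    search : {T : ℕ × ℕ → Bool} {U : ℕ × ℕ → ℕ} → Rec T → Rec U →
             ∃[ P ] ∀ n → ∃[ k ] T (n , k) ≡ true → ∃[ j ] T (n , j) ≡ true × Outputs χ P n (U (n , j))
    search rT rU = searchWith (predᴿ identity & constant 0) (notᴿ rT) (fstᴿ & sucᴿ ∘ᴿ sndᴿ) rU

-- Computations of bounded length

opaque
  haltsWithin : Oracle → Program → ℕ → ℕ → Bool
  haltsWithin χ P n k = isHalted χ P (runFor χ P k (initial n))

  result : Oracle → Program → ℕ → ℕ → ℕ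
  result χ P n k = output (runFor χ P k (initial n))

∧-true : ∀ {b c} → b ∧ c ≡ true → b ≡ true × c ≡ true
∧-true {true} {true} _ = refl , refl

isHalted⇒nothing : ∀ χ P C → isHalted χ P C ≡ true → step χ P C ≡ nothing
isHalted⇒nothing χ P C e with step χ P C
... | nothing = refl
... | just _ with () ← e

halted-runFor : ∀ χ P C k → isHalted χ P C ≡ true → runFor χ P k C ≡ C
halted-runFor χ P C zero    h = refl
halted-runFor χ P C (suc k) h =
  trans (cong (λ m → runFor χ P k (maybe′ id C m)) (isHalted⇒nothing χ P C h)) (halted-runFor χ P C k h)

runFor-+ : ∀ χ P k j C → runFor χ P (k + j) C ≡ runFor χ P j (runFor χ P k C)
runFor-+ χ P zero    j C = refl
runFor-+ χ P (suc k) j C = runFor-+ χ P k j (proceed χ P C)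

halted-later : ∀ χ P C {k k′} → isHalted χ P (runFor χ P k C) ≡ true → k ≤ k′ → runFor χ P k′ C ≡ runFor χ P k C
halted-later χ P C {k} {k′} h k≤k′ =
  trans (cong (λ k → runFor χ P k C) (sym (ℕ.m+[n∸m]≡n k≤k′)))
    (trans (runFor-+ χ P k (k′ ∸ k) C) (halted-runFor χ P (runFor χ P k C) (k′ ∸ k) h))

opaque
  unfolding haltsWithin result

  haltsWithin-mono : ∀ χ P n {k k′} → k ≤ k′ → haltsWithin χ P n k ≡ true → haltsWithin χ P n k′ ≡ true
  haltsWithin-mono χ P n k≤k′ h = trans (cong (isHalted χ P) (halted-later χ P (initial n) h k≤k′)) h

  result-later : ∀ χ P n {k k′} → haltsWithin χ P n k ≡ true → k ≤ k′ → result χ P n k′ ≡ result χ P n k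
  result-later χ P n h k≤k′ = cong output (halted-later χ P (initial n) h k≤k′)

⇓⇒runFor : ∀ {χ P C D} → χ , P ⊢ C ⇓ D → ∃[ k ] runFor χ P k C ≡ D × isHalted χ P D ≡ true
⇓⇒runFor (halt e) = 0 , refl , cong (maybe′ (λ _ → false) true) e
⇓⇒runFor {χ} {P} {C} (run e r) =
  let k , e′ , h = ⇓⇒runFor r
  in suc k , trans (cong (λ m → runFor χ P k (maybe′ id C m)) e) e′ , h

runFor⇒⇓ : ∀ χ P k C → isHalted χ P (runFor χ P k C) ≡ true → χ , P ⊢ C ⇓ runFor χ P k C
runFor⇒⇓ χ P zero    C h = halt (isHalted⇒nothing χ P C h)
runFor⇒⇓ χ P (suc k) C h = go (step χ P C) refl
  where
  go : ∀ m → step χ P C ≡ m → χ , P ⊢ C ⇓ runFor χ P k (proceed χ P C)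
  go (just C′) e =
    run (trans e (cong just (sym (cong (maybe′ id C) e)))) (runFor⇒⇓ χ P k (proceed χ P C) h)
  go nothing   e =
    subst (χ , P ⊢ C ⇓_) (sym (halted-runFor χ P C (suc k) (cong (maybe′ (λ _ → false) true) e))) (halt e)

opaque
  unfolding haltsWithin result

  halts⇒haltsWithin : ∀ {χ P n} → Halts χ P n → ∃[ k ] haltsWithin χ P n k ≡ true
  halts⇒haltsWithin {χ} {P} (D , r) =
    let k , e , h = ⇓⇒runFor r
    in k , trans (cong (isHalted χ P) e) h

  haltsWithin⇒halts : ∀ {χ P n} k → haltsWithin χ P n k ≡ true → Halts χ P n
  haltsWithin⇒halts {χ} {P} {n} k h = runFor χ P k (initial n) , runFor⇒⇓ χ P k (initial n) h

outputs⇒halts : ∀ {χ P n m} → Outputs χ P n m → Halts χ P n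
outputs⇒halts (D , r , _) = D , r

opaque
  unfolding haltsWithin result

  -- Both `k` and the length of the given run are times at which the machine has halted, and from
  -- the smaller of them on the configuration is constant.
  result-unique : ∀ {χ P n m} k → Outputs χ P n m → haltsWithin χ P n k ≡ true → result χ P n k ≡ m
  result-unique {χ} {P} {n} k (D , r , output≡m) h =
    let k′ , e , h′ = ⇓⇒runFor r
    in trans (cong output (trans (meet k′ (trans (cong (isHalted χ P) e) h′)) e)) output≡m
    where
    meet : ∀ k′ → haltsWithin χ P n k′ ≡ true → runFor χ P k (initial n) ≡ runFor χ P k′ (initial n)
    meet k′ h′ with ℕ.≤-total k k′
    ... | inj₁ k≤k′ = sym (halted-later χ P (initial n) h k≤k′)
    ... | inj₂ k′≤k = halted-later χ P (initial n) h′ k′≤k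

oracle-proceed : ∀ χ P C → Configuration.oracle (proceed χ P C) ≤ suc (Configuration.oracle C)
oracle-proceed χ P C = go (find (applies? state (Tape.scanned work) (χ oracle)) P)
  where
  open Configuration C
  bound : ∀ m o → shiftOracle m o ≤ suc o
  bound left  o = ℕ.m≤n⇒m≤1+n ℕ.pred[n]≤n
  bound stay  o = ℕ.n≤1+n o
  bound right o = ℕ.≤-refl
  go : ∀ m → Configuration.oracle (maybe′ id C (Maybe.map (execute C) m)) ≤ suc oracle
  go nothing  = ℕ.n≤1+n oracle
  go (just I) = bound (Instruction.oracleMove I) oracle

step-agree : ∀ χ χ′ P C → χ (Configuration.oracle C) ≡ χ′ (Configuration.oracle C) → step χ P C ≡ step χ′ P C
step-agree χ χ′ P C e = cong (λ b → Maybe.map (execute C) (find (applies? state (Tape.scanned work) b) P)) e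
  where open Configuration C

-- In k steps the oracle head cannot move beyond cell k.
run-agree : ∀ χ χ′ P k C → (∀ i → i ≤ k + Configuration.oracle C → χ i ≡ χ′ i) →
            runFor χ P k C ≡ runFor χ′ P k C × isHalted χ P (runFor χ P k C) ≡ isHalted χ′ P (runFor χ′ P k C)
run-agree χ χ′ P zero C same =
  refl , cong (maybe′ (λ _ → false) true) (step-agree χ χ′ P C (same (Configuration.oracle C) ℕ.≤-refl))
run-agree χ χ′ P (suc k) C same =
  let eq , eq′ = run-agree χ χ′ P k (proceed χ P C)
        (λ i i≤ → same i (ℕ.≤-trans i≤ (ℕ.≤-trans (ℕ.+-monoʳ-≤ k (oracle-proceed χ P C)) (ℕ.≤-reflexive (ℕ.+-suc k o)))))
  in trans eq (cong (λ m → runFor χ′ P k (maybe′ id C m)) C→) ,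
     trans eq′ (cong (λ m → isHalted χ′ P (runFor χ′ P k (maybe′ id C m))) C→)
  where
  o : ℕ
  o = Configuration.oracle C
  C→ : step χ P C ≡ step χ′ P C
  C→ = step-agree χ χ′ P C (same o (ℕ.m≤n+m o (suc k)))

opaque
  unfolding haltsWithin result

  initial-agree : ∀ χ χ′ P n {k} → (∀ i → i ≤ k → χ i ≡ χ′ i) →
                  result χ P n k ≡ result χ′ P n k × haltsWithin χ P n k ≡ haltsWithin χ′ P n k
  initial-agree χ χ′ P n {k} same =
    let eq , eq′ = run-agree χ χ′ P k (initial n) (λ i i≤ → same i (subst (i ≤_) (ℕ.+-identityʳ k) i≤))
    in cong output eq , eq′

-- Stages of the halting set and comparison of oracles

≡ᵇ-true⇒≡ : ∀ m n → (m ≡ᵇ n) ≡ true → m ≡ n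
≡ᵇ-true⇒≡ m n e = ℕ.≡ᵇ⇒≡ m n (Equivalence.from Bool.T-≡ e)

≡ᵇ-refl : ∀ n → (n ≡ᵇ n) ≡ true
≡ᵇ-refl n = Equivalence.to Bool.T-≡ (ℕ.≡⇒≡ᵇ n n refl)

-- `decodeProgram` turns every number into a program; the first conjunct rejects those `x` that are
-- not the code of the program obtained.
∅′At : ℕ → ℕ → Bool
∅′At k x = (⌜ decodeProgram x ⌝ ≡ᵇ x) ∧ haltsWithin noOracle (decodeProgram x) x k

∅′At-mono : ∀ x {k k′} → k ≤ k′ → ∅′At k x ≡ true → ∅′At k′ x ≡ true
∅′At-mono x k≤k′ h =
  let e , h′ = ∧-true h
  in cong₂ _∧_ e (haltsWithin-mono noOracle (decodeProgram x) x k≤k′ h′)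

∅′At⇒∅′ : ∀ k x → ∅′At k x ≡ true → ∅′ x
∅′At⇒∅′ k x h =
  let e , h′ = ∧-true h
  in decodeProgram x , sym (≡ᵇ-true⇒≡ ⌜ decodeProgram x ⌝ x e) , haltsWithin⇒halts k h′

∅′⇒∅′At : ∀ x → ∅′ x → ∃[ k ] ∅′At k x ≡ true
∅′⇒∅′At x (P , x≡⌜P⌝ , halts) =
  let k , h = halts⇒haltsWithin halts
  in k , cong₂ _∧_ (trans (cong (λ Q → ⌜ Q ⌝ ≡ᵇ x) decode-x) (trans (cong (_≡ᵇ x) (sym x≡⌜P⌝)) (≡ᵇ-refl x)))
           (trans (cong (λ Q → haltsWithin noOracle Q x k) decode-x) h)
  where
  decode-x : decodeProgram x ≡ P
  decode-x = trans (cong decodeProgram x≡⌜P⌝) (decodeProgram-⌜⌝ P)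

agreesFrom : Oracle → Oracle → ℕ × Bool → ℕ × Bool
agreesFrom χ χ′ (i , b) = suc i , b ∧ (bit (χ i) ≡ᵇ bit (χ′ i))

-- There are `suc u` rounds, for cells `0` to `u` inclusive: in `u` steps the oracle head can get as
-- far as cell `u`.
agreeUpTo : Oracle → Oracle → ℕ → Bool
agreeUpTo χ χ′ u = proj₂ (iterate (agreesFrom χ χ′) (0 , true) (suc u))

agreeUpTo-⇔ : ∀ {χ χ′ u} → agreeUpTo χ χ′ u ≡ true ⇔ (∀ i → i ≤ u → χ i ≡ χ′ i)
agreeUpTo-⇔ {χ} {χ′} {u} =
  mk⇔ (λ e i i≤u → sound (suc u) i (s≤s i≤u) e) (λ same → complete (suc u) (λ { i (s≤s i≤u) → same i i≤u }))
  where
  I : ℕ → ℕ × Bool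
  I = iterate (agreesFrom χ χ′) (0 , true)
  I-suc : ∀ k → I (suc k) ≡ agreesFrom χ χ′ (I k)
  I-suc k = iterate-commute (agreesFrom χ χ′) (0 , true) k
  position : ∀ k → proj₁ (I k) ≡ k
  position zero    = refl
  position (suc k) = trans (cong proj₁ (I-suc k)) (cong suc (position k))
  I-suc₂ : ∀ k → proj₂ (I (suc k)) ≡ proj₂ (I k) ∧ (bit (χ k) ≡ᵇ bit (χ′ k))
  I-suc₂ k = trans (cong proj₂ (I-suc k)) (cong (λ i → proj₂ (I k) ∧ (bit (χ i) ≡ᵇ bit (χ′ i))) (position k))
  bit-injective : ∀ b c → bit b ≡ bit c → b ≡ c
  bit-injective false false _ = refl
  bit-injective true  true  _ = refl
  sound : ∀ k i → suc i ≤ k → proj₂ (I k) ≡ true → χ i ≡ χ′ i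
  sound (suc k) i (s≤s i≤k) e with e₁ , e₂ ← ∧-true (trans (sym (I-suc₂ k)) e) with ℕ.m≤n⇒m<n∨m≡n i≤k
  ... | inj₁ i<k  = sound k i i<k e₁
  ... | inj₂ refl = bit-injective (χ i) (χ′ i) (≡ᵇ-true⇒≡ _ _ e₂)
  complete : ∀ k → (∀ i → suc i ≤ k → χ i ≡ χ′ i) → proj₂ (I k) ≡ true
  complete zero    same = refl
  complete (suc k) same =
    trans (I-suc₂ k) (cong₂ _∧_ (complete k (λ i i<k → same i (ℕ.m≤n⇒m≤1+n i<k)))
      (trans (cong (λ b → bit b ≡ᵇ bit (χ′ k)) (same k ℕ.≤-refl)) (≡ᵇ-refl (bit (χ′ k)))))

-- Realizers for bounded computations

module Stages (χ : Oracle) where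
  open Realizability χ
  open Realizers χ

  module _ {Γ : Set} ⦃ _ : Coded Γ ⦄ where

    opaque
      unfolding haltsWithin result

      haltsWithinᴿ : {ω : Γ × ℕ → Bool} {P : Γ → Program} {n k : Γ → ℕ} → Rec ω → Rec P → Rec n → Rec k →
                     Rec (λ γ → haltsWithin (λ i → ω (γ , i)) (P γ) (n γ) (k γ))
      haltsWithinᴿ rω rP rn rk = isHaltedᴿ rω rP (runForᴿ rω rP rk (initialᴿ rn))

      resultᴿ : {ω : Γ × ℕ → Bool} {P : Γ → Program} {n k : Γ → ℕ} → Rec ω → Rec P → Rec n → Rec k →
                Rec (λ γ → result (λ i → ω (γ , i)) (P γ) (n γ) (k γ))
      resultᴿ rω rP rn rk = outputᴿ (runForᴿ rω rP rk (initialᴿ rn))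

  module _ {Γ : Set} ⦃ _ : Coded Γ ⦄ where

    ∅′Atᴿ : {k x : Γ → ℕ} → Rec k → Rec x → Rec (λ γ → ∅′At (k γ) (x γ))
    ∅′Atᴿ rk rx = ∧ᴿ (≡ᵇᴿ (⌜⌝ᴿ ∘ᴿ decodeProgramᴿ ∘ᴿ rx) rx) (haltsWithinᴿ (constant false) (decodeProgramᴿ ∘ᴿ rx) rx rk)

    agreeUpToᴿ : {ω ω′ : Γ × ℕ → Bool} {u : Γ → ℕ} → Rec ω → Rec ω′ → Rec u →
                 Rec (λ γ → agreeUpTo (λ i → ω (γ , i)) (λ i → ω′ (γ , i)) (u γ))
    agreeUpToᴿ {ω} {ω′} rω rω′ ru =
      sndᴿ ∘ᴿ iterateᴿ {f = λ (γ , p) → agreesFrom (λ i → ω (γ , i)) (λ i → ω′ (γ , i)) p}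
        (sucᴿ ∘ᴿ fstᴿ ∘ᴿ sndᴿ & ∧ᴿ (sndᴿ ∘ᴿ sndᴿ)
          (≡ᵇᴿ (bitᴿ ∘ᴿ rω ∘ᴿ (fstᴿ & fstᴿ ∘ᴿ sndᴿ)) (bitᴿ ∘ᴿ rω′ ∘ᴿ (fstᴿ & fstᴿ ∘ᴿ sndᴿ))))
        (constant (0 , true)) (sucᴿ ∘ᴿ ru)

-- The universal function and its totalization modulo the numbering

φ : ℕ → Program
φ n = decodeProgram (proj₁ (unpair n))

φ-pair : ∀ P x → φ (pair ⌜ P ⌝ x) ≡ P
φ-pair P x = trans (cong decodeProgram (fst-pair ⌜ P ⌝ x)) (decodeProgram-⌜⌝ P)

-- The diagonal function n ↦ φₑ(n), n = ⟨e, x⟩, is partial computable; a total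
-- function f extending it modulo γ satisfies f ⟨e, x⟩ ∼ φₑ ⟨e, x⟩, where e may
-- be chosen with knowledge of f.
diagonal-totalization : ∀ {c ℓ} {S : Setoid c ℓ} (γ : Numbering S) → Precomplete γ →
  ∃[ f ] Computable f × (∀ P x m → Outputs noOracle P (pair ⌜ P ⌝ x) m → f (pair ⌜ P ⌝ x) ∼[ γ ] m)
diagonal-totalization γ precomplete = f , f-computable , λ P x m out → f-extends _ m (universal-outputs P x m out)
  where
  open Realizability noOracle
  open Realizers noOracle
  open Stages noOracle
  φᴿ : Rec (φ ∘ proj₁)
  φᴿ = decodeProgramᴿ ∘ᴿ fstᴿ ∘ᴿ unpairᴿ ∘ᴿ fstᴿ
  universal : ∃[ P ] ∀ n → ∃[ k ] haltsWithin noOracle (φ n) n k ≡ true →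
              ∃[ j ] haltsWithin noOracle (φ n) n j ≡ true × Outputs noOracle P n (result noOracle (φ n) n j)
  universal = search {T = λ (n , k) → haltsWithin noOracle (φ n) n k} {U = λ (n , k) → result noOracle (φ n) n k}
                (haltsWithinᴿ (constant false) φᴿ fstᴿ sndᴿ) (resultᴿ (constant false) φᴿ fstᴿ sndᴿ)
  universal-outputs : ∀ P x m → Outputs noOracle P (pair ⌜ P ⌝ x) m → Outputs noOracle (proj₁ universal) (pair ⌜ P ⌝ x) m
  universal-outputs P x m out =
    subst (Outputs noOracle (proj₁ universal) n) (result-unique {noOracle} {φ n} {n} j out′ h) u
    where
    n : ℕ
    n = pair ⌜ P ⌝ x
    out′ : Outputs noOracle (φ n) n m
    out′ = subst (λ Q → Outputs noOracle Q n m) (sym (φ-pair P x)) out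
    found : ∃[ j ] haltsWithin noOracle (φ n) n j ≡ true ×
              Outputs noOracle (proj₁ universal) n (result noOracle (φ n) n j)
    found = proj₂ universal n (halts⇒haltsWithin {noOracle} {φ n} {n} (outputs⇒halts {noOracle} {φ n} {n} {m} out′))
    j : ℕ
    j = proj₁ found
    h : haltsWithin noOracle (φ n) n j ≡ true
    h = proj₁ (proj₂ found)
    u : Outputs noOracle (proj₁ universal) n (result noOracle (φ n) n j)
    u = proj₂ (proj₂ found)
  totalization : ∃[ f ] Computable f × (∀ n m → Outputs noOracle (proj₁ universal) n m → f n ∼[ γ ] m)
  totalization = precomplete (Outputs noOracle (proj₁ universal)) (proj₁ universal , λ n m → mk⇔ id id)
  f : ℕ → ℕ
  f = proj₁ totalization
  f-computable : Computable f
  f-computable = proj₁ (proj₂ totalization)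
  f-extends : ∀ n m → Outputs noOracle (proj₁ universal) n m → f n ∼[ γ ] m
  f-extends = proj₂ (proj₂ totalization)

-- Approximating an A-computable function, A computably enumerable

module Approximation (E G : Program) where

  stage : ℕ → Oracle
  stage s i = haltsWithin noOracle E i s

  -- One number `t` bounds both the enumeration and the run. If the run has not halted by then, the
  -- strokes of the unfinished tape are counted, so the function is total.
  approximation : ℕ → ℕ → ℕ
  approximation t y = result (stage t) G y t

  -- A run of `u` steps reads no cell beyond `u`, so agreement up to `u` makes the halting run on
  -- stage `s` a run on `α`. With `α` as oracle, the condition is decidable.
  Modulus : Oracle → ℕ → ℕ → ℕ → Bool
  Modulus α y u s = haltsWithin (stage s) G y u ∧ agreeUpTo (stage s) α u

  Modulus-cong : ∀ α {y y′ u u′ s s′} → y ≡ y′ → u ≡ u′ → s ≡ s′ → Modulus α y u s ≡ true → Modulus α y′ u′ s′ ≡ true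
  Modulus-cong α refl refl refl m = m

  module _ (χ : Oracle) {Γ : Set} ⦃ _ : Coded Γ ⦄ where
    open Realizability χ
    open Stages χ

    stageᴿ : {s i : Γ → ℕ} → Rec s → Rec i → Rec (λ γ → stage (s γ) (i γ))
    stageᴿ rs ri = haltsWithinᴿ (constant false) (constant E) ri rs

  module _ (χ : Oracle) {Γ : Set} ⦃ _ : Coded Γ ⦄ where
    open Realizability χ
    open Stages χ
    open Realizers χ

    approximationᴿ : {t y : Γ → ℕ} → Rec t → Rec y → Rec (λ γ → approximation (t γ) (y γ))
    approximationᴿ {t} rt ry =
      resultᴿ {ω = λ (γ , i) → stage (t γ) i} (stageᴿ χ (rt ∘ᴿ fstᴿ) sndᴿ) (constant G) ry rt

    Modulusᴿ : {y u s : Γ → ℕ} → Rec y → Rec u → Rec s → Rec (λ γ → Modulus χ (y γ) (u γ) (s γ))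
    Modulusᴿ {s = s} ry ru rs =
      ∧ᴿ (haltsWithinᴿ {ω = λ (γ , i) → stage (s γ) i} rstage (constant G) ry ru)
         -- This comparison is the one place where the ambient oracle is consulted.
         (agreeUpToᴿ {ω = λ (γ , i) → stage (s γ) i} rstage (queryᴿ ∘ᴿ sndᴿ) ru)
      where
      rstage : Rec (λ (γ , i) → stage (s γ) i)
      rstage = stageᴿ χ (rs ∘ᴿ fstᴿ) sndᴿ

  module _ (α : Oracle) (enumerates : ∀ i → α i ≡ true ⇔ Halts noOracle E i)
           (g : ℕ → ℕ) (computes : ∀ y → Outputs α G y (g y)) where

    stage-mono : ∀ {s t} i → s ≤ t → stage s i ≡ true → stage t i ≡ true
    stage-mono i = haltsWithin-mono noOracle E i

    stage-sound : ∀ s i → stage s i ≡ true → α i ≡ true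
    stage-sound s i = Equivalence.from (enumerates i) ∘ haltsWithin⇒halts {noOracle} {E} {i} s

    -- A stage contains no wrong elements, so it can differ from the set only by missing one.
    stage-agrees : ∀ s i → (α i ≡ true → stage s i ≡ true) → stage s i ≡ α i
    stage-agrees s i complete with stage s i in e | α i in e′
    ... | true  | true  = refl
    ... | true  | false = trans (sym (stage-sound s i e)) e′
    ... | false | true  = complete refl
    ... | false | false = refl

    -- Enumerability at work: stages grow and stay inside the set, so agreement at a cell is never
    -- lost.
    stage-agrees-later : ∀ {s t} i → s ≤ t → stage s i ≡ α i → stage t i ≡ α i
    stage-agrees-later i s≤t same = stage-agrees _ i (λ αi → stage-mono i s≤t (trans same αi))

    stage-exists : ∀ u → ∃[ s ] (∀ i → i ≤ u → stage s i ≡ α i)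
    stage-exists u = let s , same = go (suc u) in s , λ i i≤u → same i (s≤s i≤u)
      where
      one : ∀ i → ∃[ s ] stage s i ≡ α i
      one i with α i in e
      ... | false = 0 , trans (stage-agrees 0 i (λ αi → case-false (trans (sym e) αi))) e
        where
        case-false : ∀ {b} → false ≡ true → b
        case-false ()
      ... | true = halts⇒haltsWithin {noOracle} {E} {i} (Equivalence.to (enumerates i) e)
      go : ∀ u → ∃[ s ] (∀ i → suc i ≤ u → stage s i ≡ α i)
      go zero    = 0 , λ _ ()
      go (suc u) with s , same ← go u with t , same′ ← one u = s ⊔ t , both
        where
        both : ∀ i → suc i ≤ suc u → stage (s ⊔ t) i ≡ α i
        both i (s≤s i≤u) with ℕ.m≤n⇒m<n∨m≡n i≤u
        ... | inj₁ i<u  = stage-agrees-later i (ℕ.m≤m⊔n s t) (same i i<u)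
        ... | inj₂ refl = stage-agrees-later i (ℕ.m≤n⊔m s t) same′

    -- `u` is the length of the true computation on `α`, and `s` a stage late enough for all cells
    -- up to `u`.
    modulus-exists : ∀ y → ∃[ u ] ∃[ s ] Modulus α y u s ≡ true
    modulus-exists y =
      let u , h = halts⇒haltsWithin {α} {G} {y} (outputs⇒halts {α} {G} {y} {g y} (computes y))
          s , same = stage-exists u
      in u , s , cong₂ _∧_ (trans (proj₂ (initial-agree (stage s) α G y same)) h)
                   (Equivalence.from (agreeUpTo-⇔ {stage s} {α} {u}) same)

    -- Stage `t` still agrees with `α` up to `u`, so its run has halted by step `u` with the true
    -- value; the steps from `u` to `t` change nothing.
    approximation-correct : ∀ {y u s t} → Modulus α y u s ≡ true → u ≤ t → s ≤ t → approximation t y ≡ g y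
    approximation-correct {y} {u} {s} {t} modulus u≤t s≤t =
      let halts , agree = ∧-true modulus
          same = Equivalence.to (agreeUpTo-⇔ {stage s} {α} {u}) agree
          α-halts = trans (sym (proj₂ (initial-agree (stage s) α G y same))) halts
          result≡ , halts≡ = initial-agree (stage t) α G y (λ i i≤u → stage-agrees-later i s≤t (same i i≤u))
      in trans (result-later (stage t) G y (trans halts≡ α-halts) u≤t)
           (trans result≡ (result-unique {α} {G} {y} u (computes y) α-halts))

-- Components are bounded by their code, so the code of a modulus can itself serve as a stage beyond
-- it.
proj₁-unpair≤ : ∀ n → proj₁ (unpair n) ≤ n
proj₁-unpair≤ n = subst (proj₁ (unpair n) ≤_) (pair-unpair n) (m≤pair (proj₁ (unpair n)) (proj₂ (unpair n)))
  where
  n≤triangle : ∀ n → n ≤ triangle n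
  n≤triangle zero    = z≤n
  n≤triangle (suc n) = ℕ.m≤m+n (suc n) (triangle n)
  m≤pair : ∀ m n → m ≤ pair m n
  m≤pair m n = ℕ.m≤n⇒m≤n+o n (ℕ.≤-trans (ℕ.m≤m+n m n) (n≤triangle (m + n)))

proj₂-unpair≤ : ∀ n → proj₂ (unpair n) ≤ n
proj₂-unpair≤ n = subst (proj₂ (unpair n) ≤_) (pair-unpair n) (n≤pair (proj₁ (unpair n)) (proj₂ (unpair n)))

-- Deciding the halting set from the enumerable oracle

module Reduction
  (E F G : Program) (α : Oracle) (enumerates : ∀ i → α i ≡ true ⇔ Halts noOracle E i)
  (f : ℕ → ℕ) (f-computed : ∀ n → Outputs noOracle F n (f n))
  (g : ℕ → ℕ) (g-computed : ∀ y → Outputs α G y (g y)) where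

  open Approximation E G

  f-halts : ∀ n → ∃[ k ] haltsWithin noOracle F n k ≡ true
  f-halts n = halts⇒haltsWithin {noOracle} {F} {n} (outputs⇒halts {noOracle} {F} {n} {f n} (f-computed n))

  f-result : ∀ n k → haltsWithin noOracle F n k ≡ true → result noOracle F n k ≡ f n
  f-result n k = result-unique {noOracle} {F} {n} k (f-computed n)

  -- The claim holds for every `n` and does not involve the code of `D`; that code is put into the
  -- first component of `n` afterwards.
  diagonalProgram : ∃[ D ] ∀ n → ∅′ (proj₂ (unpair n)) →
                    ∃[ k ] ∅′At k (proj₂ (unpair n)) ≡ true × Outputs noOracle D n (approximation k (f n))
  diagonalProgram = proj₁ program , λ n x∈∅′ → outputs n x∈∅′
    where
    open Realizability noOracle
    open Realizers noOracle
    open Stages noOracle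
    program : ∃[ D ] ∀ n → ∃[ k ] haltsWithin noOracle F n k ∧ ∅′At k (proj₂ (unpair n)) ≡ true →
              ∃[ k ] haltsWithin noOracle F n k ∧ ∅′At k (proj₂ (unpair n)) ≡ true ×
                Outputs noOracle D n (approximation k (result noOracle F n k))
    -- The `k` found suffices both to compute `f n` and to see `x` in `∅′`, so it may lie beyond the
    -- actual entry of `x`. Stages being monotone, this is harmless.
    program = search {T = λ (n , k) → haltsWithin noOracle F n k ∧ ∅′At k (proj₂ (unpair n))}
                     {U = λ (n , k) → approximation k (result noOracle F n k)}
      (∧ᴿ (haltsWithinᴿ (constant false) (constant F) fstᴿ sndᴿ) (∅′Atᴿ sndᴿ (sndᴿ ∘ᴿ unpairᴿ ∘ᴿ fstᴿ)))
      (approximationᴿ noOracle sndᴿ (resultᴿ (constant false) (constant F) fstᴿ sndᴿ))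
    outputs : ∀ n → ∅′ (proj₂ (unpair n)) →
              ∃[ k ] ∅′At k (proj₂ (unpair n)) ≡ true × Outputs noOracle (proj₁ program) n (approximation k (f n))
    outputs n x∈∅′ =
      let x = proj₂ (unpair n)
          i , h = f-halts n
          j , x∈ = ∅′⇒∅′At x x∈∅′
          k , found , out = proj₂ program n
            (i ⊔ j , cong₂ _∧_ (haltsWithin-mono noOracle F n (ℕ.m≤m⊔n i j) h) (∅′At-mono x (ℕ.m≤n⊔m i j) x∈))
          h′ , x∈′ = ∧-true found
      in k , x∈′ , subst (λ y → Outputs noOracle (proj₁ program) n (approximation k y)) (f-result n k h′) out

  e : ℕ
  e = ⌜ proj₁ diagonalProgram ⌝

  h : ℕ → ℕ
  h x = f (pair e x)

  Settled : ℕ → ℕ → Set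
  Settled x p = ∀ t → p ≤ t → approximation t (h x) ≡ g (h x)

  -- The accepted candidate `p`, read as a number, bounds the modulus that it codes. One search
  -- therefore yields the stage at which membership in `∅′` is read off.
  settlingProgram : ∃[ P ] ∀ x → ∃[ p ] Settled x p × Outputs α P x (bit (∅′At p x))
  settlingProgram = proj₁ program , outputs
    where
    open Realizability α
    open Realizers α
    open Stages α
    -- A candidate p codes a triple ⟨i, ⟨u, s⟩⟩: a number i of steps for h x, and a
    -- modulus (u, s) for g (h x).
    n i u s y : ℕ × ℕ → ℕ
    n q = pair e (proj₁ q)
    i q = proj₁ (unpair (proj₂ q))
    u q = proj₁ (unpair (proj₂ (unpair (proj₂ q))))
    s q = proj₂ (unpair (proj₂ (unpair (proj₂ q))))
    y q = result noOracle F (n q) (i q)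
    Test : ℕ × ℕ → Bool
    Test q = haltsWithin noOracle F (n q) (i q) ∧ Modulus α (y q) (u q) (s q)
    nᴿ : Rec n
    nᴿ = ident (uncurry pair) (λ _ → refl) ∘ᴿ (constant e & fstᴿ)
    iᴿ : Rec i
    iᴿ = fstᴿ ∘ᴿ unpairᴿ ∘ᴿ sndᴿ
    uᴿ : Rec u
    uᴿ = fstᴿ ∘ᴿ unpairᴿ ∘ᴿ sndᴿ ∘ᴿ unpairᴿ ∘ᴿ sndᴿ
    sᴿ : Rec s
    sᴿ = sndᴿ ∘ᴿ unpairᴿ ∘ᴿ sndᴿ ∘ᴿ unpairᴿ ∘ᴿ sndᴿ
    yᴿ : Rec y
    yᴿ = resultᴿ (constant false) (constant F) nᴿ iᴿ
    haltsᴿ : Rec (λ q → haltsWithin noOracle F (n q) (i q))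
    haltsᴿ = haltsWithinᴿ (constant false) (constant F) nᴿ iᴿ
    modulusᴿ : Rec (λ q → Modulus α (y q) (u q) (s q))
    modulusᴿ = Modulusᴿ α {y = y} {u = u} {s = s} yᴿ uᴿ sᴿ
    program : ∃[ P ] ∀ x → ∃[ p ] Test (x , p) ≡ true → ∃[ p ] Test (x , p) ≡ true × Outputs α P x (bit (∅′At p x))
    program = search {T = Test} {U = λ (x , p) → bit (∅′At p x)} (∧ᴿ haltsᴿ modulusᴿ) (bitᴿ ∘ᴿ ∅′Atᴿ sndᴿ fstᴿ)
    Test-triple : ∀ x j k l → haltsWithin noOracle F (pair e x) j ≡ true → Modulus α (h x) k l ≡ true →
                  Test (x , pair j (pair k l)) ≡ true
    Test-triple x j k l halts modulus =
      cong₂ _∧_ {haltsWithin noOracle F (n q) (i q)} {true} {Modulus α (y q) (u q) (s q)} {true} halts′ modulus′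
      where
      q : ℕ × ℕ
      q = x , pair j (pair k l)
      i≡ : i q ≡ j
      i≡ = fst-pair j (pair k l)
      u≡ : u q ≡ k
      u≡ = trans (cong (λ p → proj₁ (unpair p)) (snd-pair j (pair k l))) (fst-pair k l)
      s≡ : s q ≡ l
      s≡ = trans (cong (λ p → proj₂ (unpair p)) (snd-pair j (pair k l))) (snd-pair k l)
      halts′ : haltsWithin noOracle F (n q) (i q) ≡ true
      halts′ = subst (λ i → haltsWithin noOracle F (n q) i ≡ true) (sym i≡) halts
      y≡ : y q ≡ h x
      y≡ = f-result (n q) (i q) halts′
      modulus′ : Modulus α (y q) (u q) (s q) ≡ true
      modulus′ = Modulus-cong α {h x} {y q} {k} {u q} {l} {s q} (sym y≡) (sym u≡) (sym s≡) modulus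
    Test-settled : ∀ x p → Test (x , p) ≡ true → Settled x p
    Test-settled x p found t p≤t =
      approximation-correct α enumerates g g-computed {h x} {u q} {s q} {t}
        (Modulus-cong α {y q} {h x} {u q} {u q} {s q} {s q} (f-result (n q) (i q) (proj₁ parts)) refl refl (proj₂ parts))
        (ℕ.≤-trans (proj₁-unpair≤ (proj₂ (unpair p))) us≤t)
        (ℕ.≤-trans (proj₂-unpair≤ (proj₂ (unpair p))) us≤t)
      where
      q : ℕ × ℕ
      q = x , p
      parts : haltsWithin noOracle F (n q) (i q) ≡ true × Modulus α (y q) (u q) (s q) ≡ true
      parts = ∧-true {haltsWithin noOracle F (n q) (i q)} {Modulus α (y q) (u q) (s q)} found
      us≤t : proj₂ (unpair p) ≤ t
      us≤t = ℕ.≤-trans (proj₂-unpair≤ p) p≤t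
    outputs : ∀ x → ∃[ p ] Settled x p × Outputs α (proj₁ program) x (bit (∅′At p x))
    outputs x = proj₁ found , Test-settled x (proj₁ found) (proj₁ (proj₂ found)) , proj₂ (proj₂ found)
      where
      value : ∃[ j ] haltsWithin noOracle F (pair e x) j ≡ true
      value = f-halts (pair e x)
      modulus : ∃[ k ] ∃[ l ] Modulus α (h x) k l ≡ true
      modulus = modulus-exists α enumerates g g-computed (h x)
      found : ∃[ p ] Test (x , p) ≡ true × Outputs α (proj₁ program) x (bit (∅′At p x))
      found = proj₂ program x
        (pair (proj₁ value) (pair (proj₁ modulus) (proj₁ (proj₂ modulus))) ,
         Test-triple x (proj₁ value) (proj₁ modulus) (proj₁ (proj₂ modulus)) (proj₂ value) (proj₂ (proj₂ modulus)))

  -- Let `k` be the stage found by the diagonal program. If `k ≤ p`, monotonicity puts `x` into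
  -- stage `p`; if `p ≤ k`, the approximation that it outputs has settled.
  late-entry : ∀ x p → Settled x p → ∅′ x →
               ∅′At p x ≡ true ⊎ Outputs noOracle (proj₁ diagonalProgram) (pair e x) (g (h x))
  late-entry x p settled x∈∅′ = go (ℕ.≤-total k p)
    where
    entry : ∃[ k ] ∅′At k (proj₂ (unpair (pair e x))) ≡ true ×
              Outputs noOracle (proj₁ diagonalProgram) (pair e x) (approximation k (h x))
    entry = proj₂ diagonalProgram (pair e x) (subst ∅′ (sym (snd-pair e x)) x∈∅′)
    k : ℕ
    k = proj₁ entry
    go : k ≤ p ⊎ p ≤ k → ∅′At p x ≡ true ⊎ Outputs noOracle (proj₁ diagonalProgram) (pair e x) (g (h x))
    go (inj₁ k≤p) = inj₁ (∅′At-mono x k≤p (subst (λ x → ∅′At k x ≡ true) (snd-pair e x) (proj₁ (proj₂ entry))))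
    go (inj₂ p≤k) = inj₂ (subst (Outputs noOracle (proj₁ diagonalProgram) (pair e x)) (settled k p≤k) (proj₂ (proj₂ entry)))

-- Without fixed points the late case of `late-entry` is impossible: there the diagonal program
-- outputs `g (h x)`, and `f` extends it modulo `γ`, so `h x ∼ g (h x)`. Stage `p` is then right
-- about `x` in both directions.
fixedPointFree⇒∅′≤A : (em : ∀ {a} → ExcludedMiddle a) → let open Relative em in
  ∀ {c ℓ} (S : Setoid c ℓ) (γ : Numbering S) → Precomplete γ →
  (A : Pred ℕ 0ℓ) → ComputablyEnumerable A → (g : ℕ → ℕ) → A -Computable g →
  ¬ (∃[ n ] g n ∼[ γ ] n) → ∅′ ≤T A
fixedPointFree⇒∅′≤A em S γ precomplete A (E , A⇔) g (G , g-computed) fixedPointFree = proj₁ settlingProgram , outputs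
  where
  open Relative em
  α : Oracle
  α = characteristic A
  enumerates : ∀ i → α i ≡ true ⇔ Halts noOracle E i
  enumerates i = go em
    where
    go : (d : Dec (A i)) → does d ≡ true ⇔ Halts noOracle E i
    go (yes Ai) = mk⇔ (λ _ → Equivalence.to (A⇔ i) Ai) (λ _ → refl)
    go (no ¬Ai) = mk⇔ (λ ()) (λ halts → ⊥-elim (¬Ai (Equivalence.from (A⇔ i) halts)))
  totalization : ∃[ f ] Computable f × (∀ P x m → Outputs noOracle P (pair ⌜ P ⌝ x) m → f (pair ⌜ P ⌝ x) ∼[ γ ] m)
  totalization = diagonal-totalization γ precomplete
  f : ℕ → ℕ
  f = proj₁ totalization
  F : Program
  F = proj₁ (proj₁ (proj₂ totalization))
  f-computed : ∀ n → Outputs noOracle F n (f n)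
  f-computed = proj₂ (proj₁ (proj₂ totalization))
  open Reduction E F G α enumerates f f-computed g g-computed
  decides : ∀ x p → Settled x p → (d : Dec (∅′ x)) → ∅′At p x ≡ does d
  decides x p settled (no x∉∅′)  = Bool.¬-not (x∉∅′ ∘ ∅′At⇒∅′ p x)
  decides x p settled (yes x∈∅′) = go (late-entry x p settled x∈∅′)
    where
    go : ∅′At p x ≡ true ⊎ Outputs noOracle (proj₁ diagonalProgram) (pair e x) (g (h x)) → ∅′At p x ≡ true
    go (inj₁ early) = early
    go (inj₂ late)  = ⊥-elim (fixedPointFree
      (h x , Setoid.sym S (proj₂ (proj₂ totalization) (proj₁ diagonalProgram) x (g (h x)) late)))
  outputs : ∀ x → Outputs α (proj₁ settlingProgram) x (bit (characteristic ∅′ x))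
  outputs x = subst (Outputs α (proj₁ settlingProgram) x) (cong bit (decides x p settled em)) out
    where
    found : ∃[ p ] Settled x p × Outputs α (proj₁ settlingProgram) x (bit (∅′At p x))
    found = proj₂ settlingProgram x
    p : ℕ
    p = proj₁ found
    settled : Settled x p
    settled = proj₁ (proj₂ found)
    out : Outputs α (proj₁ settlingProgram) x (bit (∅′At p x))
    out = proj₂ (proj₂ found)

theorem5p1 : (em : ∀ {a} → ExcludedMiddle a) →
    let open Relative em in
    ∀ {c ℓ} (S : Setoid c ℓ) (γ : Numbering S) → Precomplete γ →
    (A : Pred ℕ 0ℓ) → ComputablyEnumerable A → A <T ∅′ →
    (g : ℕ → ℕ) → A -Computable g →
    ∃[ n ] g n ∼[ γ ] n
theorem5p1 em S γ precomplete A A-ce (_ , ∅′≰A) g g-computable =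
  -- The argument refutes the absence of a fixed point; excluded middle removes the double negation.
  decidable-stable em (∅′≰A ∘ fixedPointFree⇒∅′≤A em S γ precomplete A A-ce g g-computable)
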